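{- For every finite simple graph $G$ with complement $\overline{G}$, \[ \xi_f(\overline{G}) = \operatorname{mr}_f^+(G). \]
   Context: All graphs are finite and simple; $\overline{G}$ has the same vertex set as $G$, and distinct $u,v$ are adjacent in $\overline{G}$ iff they are not adjacent in $G$. For $d,r\in\mathbb{N}$ with $r\le d$, a $d/r$-representation of a graph $H$ is an assignment of matrices $P_u\in\mathbb{C}^{d\times d}$, $u\in V(H)$, with $\operatorname{rank}P_u=r$, $P_u^*=P_u$, $P_u^2=P_u$, such that $P_uP_v=0$ whenever $uv\in E(H)$. The projective rank is $\xi_f(H)=\inf\{d/r : H \text{ has a } d/r\text{ -representation}\}$. A $(d;r)$ faithful orthogonal subspace representation of $G$ is a family $\{S_u\}_{u\in V(G)}$ of $r$-dimensional subspaces of $\mathbb{C}^d$ such that for distinct $u,v$, $S_u\perp S_v$ if and only if $uv\notin E(G)$. The $r$-fold minimum positive semidefinite rank $\operatorname{mr}^+_{[r]}(G)$ is the minimum $d$ such that $G$ has a $(d;r)$ faithful orthogonal subspace representation, and the fractional minimum positive semidefinite rank is $\operatorname{mr}^+_f(G)=\inf_{r\in\mathbb{N}} \operatorname{mr}^+_{[r]}(G)/r$. -}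

module Defs where

open import Data.Nat.Base as ℕ using (ℕ; NonZero)
import Data.Nat.Properties as ℕ
open import Data.Integer.Base using (+_)
open import Data.Rational.Base as ℚ using (ℚ; 0ℚ; 1ℚ; ½; ∣_∣)
import Data.Rational.Properties as ℚ
open import Data.Rational.Solver using (module +-*-Solver)
open import Data.Fin.Base using (Fin)
open import Data.Vec.Functional using (Vector)
open import Data.Product.Base using (Σ-syntax; ∃-syntax; _×_; _,_; proj₁; proj₂)
open import Algebra.Bundles.Raw using (RawMonoid)
import Algebra.Definitions.RawMonoid as RawMonoidDefs
open import Function.Bundles using (_⇔_)
open import Level using (Level; 0ℓ; suc)
open import Relation.Nullary.Negation.Core using (¬_)
open import Relation.Unary using (Pred)
open import Relation.Binary.Core using (Rel)
open import Relation.Binary.Definitions using (Symmetric; Irreflexive)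
open import Relation.Binary.PropositionalEquality
  using (_≡_; _≢_; refl; sym; cong; trans; cong₂; subst)

-- Real numbers: Cauchy sequences of rationals, where sequences with the
-- same limit are identified by the equivalence _≃_.

IsCauchy : (ℕ → ℚ) → Set
IsCauchy s = ∀ ε → 0ℚ ℚ.< ε →
  ∃[ N ] (∀ m n → N ℕ.≤ m → N ℕ.≤ n → ∣ s m ℚ.- s n ∣ ℚ.< ε)

record ℝ : Set where
  constructor mkℝ
  field
    seq    : ℕ → ℚ
    cauchy : IsCauchy seq

open ℝ public

infix 4 _≃_ _≤ᵣ_

_≃_ : Rel ℝ 0ℓ
x ≃ y = ∀ ε → 0ℚ ℚ.< ε →
  ∃[ N ] (∀ n → N ℕ.≤ n → ∣ seq x n ℚ.- seq y n ∣ ℚ.< ε)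

-- lim x ≤ lim y.  The slack ε is needed: the terms of x may exceed those
-- of y by an amount tending to zero.
_≤ᵣ_ : Rel ℝ 0ℓ
x ≤ᵣ y = ∀ ε → 0ℚ ℚ.< ε →
  ∃[ N ] (∀ n → N ℕ.≤ n → seq x n ℚ.≤ seq y n ℚ.+ ε)

abstract
  half-pos : ∀ {ε} → 0ℚ ℚ.< ε → 0ℚ ℚ.< ε ℚ.* ½
  half-pos {ε} 0<ε =
    subst (ℚ._< ε ℚ.* ½) (ℚ.*-zeroˡ ½) (ℚ.*-monoˡ-<-pos ½ 0<ε)

  halves : ∀ ε → ε ℚ.* ½ ℚ.+ ε ℚ.* ½ ≡ ε
  halves = solve 1 (λ ε → ε :* con ½ :+ ε :* con ½ := ε) refl
    where open +-*-Solver

  const-cauchy : ∀ q → IsCauchy (λ _ → q)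
  const-cauchy q ε 0<ε = 0 , λ _ _ _ _ →
    subst (λ z → ∣ z ∣ ℚ.< ε) (sym (ℚ.+-inverseʳ q)) 0<ε

  +-cauchy : ∀ s t → IsCauchy s → IsCauchy t →
             IsCauchy (λ n → s n ℚ.+ t n)
  +-cauchy s t cs ct ε 0<ε
    with cs (ε ℚ.* ½) (half-pos 0<ε) | ct (ε ℚ.* ½) (half-pos 0<ε)
  ... | M , hs | N , ht = M ℕ.⊔ N , λ m n M⊔N≤m M⊔N≤n → begin-strict
    ∣ (s m ℚ.+ t m) ℚ.- (s n ℚ.+ t n) ∣
      ≡⟨ cong ∣_∣ (rearrange (s m) (t m) (s n) (t n)) ⟩
    ∣ (s m ℚ.- s n) ℚ.+ (t m ℚ.- t n) ∣
      ≤⟨ ℚ.∣p+q∣≤∣p∣+∣q∣ (s m ℚ.- s n) (t m ℚ.- t n) ⟩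
    ∣ s m ℚ.- s n ∣ ℚ.+ ∣ t m ℚ.- t n ∣
      <⟨ ℚ.+-mono-<
           (hs m n (ℕ.m⊔n≤o⇒m≤o M N M⊔N≤m) (ℕ.m⊔n≤o⇒m≤o M N M⊔N≤n))
           (ht m n (ℕ.m⊔n≤o⇒n≤o M N M⊔N≤m) (ℕ.m⊔n≤o⇒n≤o M N M⊔N≤n)) ⟩
    ε ℚ.* ½ ℚ.+ ε ℚ.* ½
      ≡⟨ halves ε ⟩
    ε ∎
    where
    open ℚ.≤-Reasoning
    rearrange : ∀ a b c d →
      (a ℚ.+ b) ℚ.- (c ℚ.+ d) ≡ (a ℚ.- c) ℚ.+ (b ℚ.- d)
    rearrange = solve 4 (λ a b c d →
      (a :+ b) :- (c :+ d) := (a :- c) :+ (b :- d)) refl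
      where open +-*-Solver

  neg-cauchy : ∀ s → IsCauchy s → IsCauchy (λ n → ℚ.- s n)
  neg-cauchy s cs ε 0<ε with cs ε 0<ε
  ... | N , hs = N , λ m n N≤m N≤n →
    subst (ℚ._< ε) (flip (s m) (s n)) (hs m n N≤m N≤n)
    where
    negate : ∀ a b → ℚ.- (a ℚ.- b) ≡ ℚ.- a ℚ.- (ℚ.- b)
    negate = solve 2 (λ a b → :- (a :- b) := :- a :- (:- b)) refl
      where open +-*-Solver
    flip : ∀ a b → ∣ a ℚ.- b ∣ ≡ ∣ ℚ.- a ℚ.- (ℚ.- b) ∣
    flip a b = trans (sym (ℚ.∣-p∣≡∣p∣ (a ℚ.- b))) (cong ∣_∣ (negate a b))

  eventually-bounded : ∀ s → IsCauchy s →
    ∃[ B ] ((0ℚ ℚ.< B) × ∃[ N ] (∀ n → N ℕ.≤ n → ∣ s n ∣ ℚ.≤ B))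
  eventually-bounded s cs with cs 1ℚ (ℚ.positive⁻¹ 1ℚ)
  ... | N , hs = 1ℚ ℚ.+ ∣ s N ∣ , 0<B , N , λ n N≤n → begin
    ∣ s n ∣                           ≡⟨ cong ∣_∣ (split (s n) (s N)) ⟩
    ∣ (s n ℚ.- s N) ℚ.+ s N ∣         ≤⟨ ℚ.∣p+q∣≤∣p∣+∣q∣ (s n ℚ.- s N) (s N) ⟩
    ∣ s n ℚ.- s N ∣ ℚ.+ ∣ s N ∣       ≤⟨ ℚ.+-monoˡ-≤ ∣ s N ∣
                                           (ℚ.<⇒≤ (hs n N N≤n ℕ.≤-refl)) ⟩
    1ℚ ℚ.+ ∣ s N ∣                    ∎
    where
    open ℚ.≤-Reasoning
    split : ∀ a b → a ≡ (a ℚ.- b) ℚ.+ b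
    split = solve 2 (λ a b → a := (a :- b) :+ b) refl
      where open +-*-Solver
    0<B : 0ℚ ℚ.< 1ℚ ℚ.+ ∣ s N ∣
    0<B = ℚ.+-mono-<-≤ (ℚ.positive⁻¹ 1ℚ) (ℚ.0≤∣p∣ (s N))

  scale-down : ∀ {B ε} → 0ℚ ℚ.< B → 0ℚ ℚ.< ε →
               ∃[ δ ] ((0ℚ ℚ.< δ) × (B ℚ.* δ ≡ ε))
  scale-down {B} {ε} 0<B 0<ε = (ℚ.1/ B) ℚ.* ε , 0<δ , Bδ≡ε
    where
    instance
      B-pos : ℚ.Positive B
      B-pos = ℚ.positive 0<B
      B≢0 : ℚ.NonZero B
      B≢0 = ℚ.pos⇒nonZero B
      1/B-pos : ℚ.Positive (ℚ.1/ B)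
      1/B-pos = ℚ.1/pos⇒pos B
    0<δ : 0ℚ ℚ.< (ℚ.1/ B) ℚ.* ε
    0<δ = subst (ℚ._< (ℚ.1/ B) ℚ.* ε) (ℚ.*-zeroʳ (ℚ.1/ B))
            (ℚ.*-monoʳ-<-pos (ℚ.1/ B) 0<ε)
    open ℚ.≤-Reasoning
    Bδ≡ε : B ℚ.* ((ℚ.1/ B) ℚ.* ε) ≡ ε
    Bδ≡ε = begin-equality
      B ℚ.* ((ℚ.1/ B) ℚ.* ε)   ≡⟨ sym (ℚ.*-assoc B (ℚ.1/ B) ε) ⟩
      (B ℚ.* (ℚ.1/ B)) ℚ.* ε   ≡⟨ cong (ℚ._* ε) (ℚ.*-inverseʳ B) ⟩
      1ℚ ℚ.* ε                 ≡⟨ ℚ.*-identityˡ ε ⟩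
      ε                        ∎

  *-bound : ∀ {a b B δ} → 0ℚ ℚ.< B → ∣ a ∣ ℚ.≤ B → ∣ b ∣ ℚ.< δ →
            ∣ a ℚ.* b ∣ ℚ.< B ℚ.* δ
  *-bound {a} {b} {B} {δ} 0<B a≤B b<δ = begin-strict
    ∣ a ℚ.* b ∣       ≡⟨ ℚ.∣p*q∣≡∣p∣*∣q∣ a b ⟩
    ∣ a ∣ ℚ.* ∣ b ∣   ≤⟨ ℚ.*-monoʳ-≤-nonNeg ∣ b ∣ {{ℚ.∣-∣-nonNeg b}} a≤B ⟩
    B ℚ.* ∣ b ∣       <⟨ ℚ.*-monoʳ-<-pos B {{ℚ.positive 0<B}} b<δ ⟩
    B ℚ.* δ           ∎
    where open ℚ.≤-Reasoning

  *-cauchy : ∀ s t → IsCauchy s → IsCauchy t →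
             IsCauchy (λ n → s n ℚ.* t n)
  *-cauchy s t cs ct ε 0<ε =
    let A , 0<A , N₁ , s≤A = eventually-bounded s cs
        B , 0<B , N₂ , t≤B = eventually-bounded t ct
        α , 0<α , Aα = scale-down 0<A (half-pos 0<ε)
        β , 0<β , Bβ = scale-down 0<B (half-pos 0<ε)
        N₃ , ht = ct α 0<α
        N₄ , hs = cs β 0<β
    in  estimate 0<A s≤A Aα 0<B t≤B Bβ ht hs
    where
    rearrange : ∀ a b c d → a ℚ.* b ℚ.- c ℚ.* d ≡
                            a ℚ.* (b ℚ.- d) ℚ.+ d ℚ.* (a ℚ.- c)
    rearrange = solve 4 (λ a b c d → a :* b :- c :* d :=
                            a :* (b :- d) :+ d :* (a :- c)) refl
      where open +-*-Solver

    estimate : ∀ {A α B β N₁ N₂ N₃ N₄} →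
      0ℚ ℚ.< A → (∀ n → N₁ ℕ.≤ n → ∣ s n ∣ ℚ.≤ A) → A ℚ.* α ≡ ε ℚ.* ½ →
      0ℚ ℚ.< B → (∀ n → N₂ ℕ.≤ n → ∣ t n ∣ ℚ.≤ B) → B ℚ.* β ≡ ε ℚ.* ½ →
      (∀ m n → N₃ ℕ.≤ m → N₃ ℕ.≤ n → ∣ t m ℚ.- t n ∣ ℚ.< α) →
      (∀ m n → N₄ ℕ.≤ m → N₄ ℕ.≤ n → ∣ s m ℚ.- s n ∣ ℚ.< β) →
      ∃[ N ] (∀ m n → N ℕ.≤ m → N ℕ.≤ n →
              ∣ s m ℚ.* t m ℚ.- s n ℚ.* t n ∣ ℚ.< ε)
    estimate {A} {α} {B} {β} {N₁} {N₂} {N₃} {N₄}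
             0<A s≤A Aα 0<B t≤B Bβ ht hs = N , λ m n N≤m N≤n → begin-strict
      ∣ s m ℚ.* t m ℚ.- s n ℚ.* t n ∣
        ≡⟨ cong ∣_∣ (rearrange (s m) (t m) (s n) (t n)) ⟩
      ∣ s m ℚ.* (t m ℚ.- t n) ℚ.+ t n ℚ.* (s m ℚ.- s n) ∣
        ≤⟨ ℚ.∣p+q∣≤∣p∣+∣q∣ (s m ℚ.* (t m ℚ.- t n)) (t n ℚ.* (s m ℚ.- s n)) ⟩
      ∣ s m ℚ.* (t m ℚ.- t n) ∣ ℚ.+ ∣ t n ℚ.* (s m ℚ.- s n) ∣
        <⟨ ℚ.+-mono-<
             (*-bound {a = s m} 0<A (s≤A m (≥₁ N≤m)) (ht m n (≥₃ N≤m) (≥₃ N≤n)))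
             (*-bound {a = t n} 0<B (t≤B n (≥₂ N≤n)) (hs m n (≥₄ N≤m) (≥₄ N≤n))) ⟩
      A ℚ.* α ℚ.+ B ℚ.* β
        ≡⟨ cong₂ ℚ._+_ Aα Bβ ⟩
      ε ℚ.* ½ ℚ.+ ε ℚ.* ½
        ≡⟨ halves ε ⟩
      ε ∎
      where
      open ℚ.≤-Reasoning
      N : ℕ
      N = (N₁ ℕ.⊔ N₂) ℕ.⊔ (N₃ ℕ.⊔ N₄)
      ≥₁ : ∀ {k} → N ℕ.≤ k → N₁ ℕ.≤ k
      ≥₁ h = ℕ.m⊔n≤o⇒m≤o N₁ N₂ (ℕ.m⊔n≤o⇒m≤o (N₁ ℕ.⊔ N₂) (N₃ ℕ.⊔ N₄) h)
      ≥₂ : ∀ {k} → N ℕ.≤ k → N₂ ℕ.≤ k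
      ≥₂ h = ℕ.m⊔n≤o⇒n≤o N₁ N₂ (ℕ.m⊔n≤o⇒m≤o (N₁ ℕ.⊔ N₂) (N₃ ℕ.⊔ N₄) h)
      ≥₃ : ∀ {k} → N ℕ.≤ k → N₃ ℕ.≤ k
      ≥₃ h = ℕ.m⊔n≤o⇒m≤o N₃ N₄ (ℕ.m⊔n≤o⇒n≤o (N₁ ℕ.⊔ N₂) (N₃ ℕ.⊔ N₄) h)
      ≥₄ : ∀ {k} → N ℕ.≤ k → N₄ ℕ.≤ k
      ≥₄ h = ℕ.m⊔n≤o⇒n≤o N₃ N₄ (ℕ.m⊔n≤o⇒n≤o (N₁ ℕ.⊔ N₂) (N₃ ℕ.⊔ N₄) h)

fromℚ : ℚ → ℝ
fromℚ q = mkℝ (λ _ → q) (const-cauchy q)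

infixl 6 _+ᵣ_
infixl 7 _*ᵣ_
infix  8 -ᵣ_

_+ᵣ_ _*ᵣ_ : ℝ → ℝ → ℝ
x +ᵣ y = mkℝ (λ n → seq x n ℚ.+ seq y n)
             (+-cauchy (seq x) (seq y) (cauchy x) (cauchy y))
x *ᵣ y = mkℝ (λ n → seq x n ℚ.* seq y n)
             (*-cauchy (seq x) (seq y) (cauchy x) (cauchy y))

-ᵣ_ : ℝ → ℝ
-ᵣ x = mkℝ (λ n → ℚ.- seq x n) (neg-cauchy (seq x) (cauchy x))

-- Infima do not exist constructively in general, so "inf S = x" is a
-- relation; it determines x up to _≃_.
IsInfimum : ∀ {ℓ} → Pred ℚ ℓ → ℝ → Set ℓ
IsInfimum S x =
  (∀ q → S q → x ≤ᵣ fromℚ q) ×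
  (∀ y → (∀ q → S q → y ≤ᵣ fromℚ q) → y ≤ᵣ x)

record ℂ : Set where
  constructor _+i_
  field
    re im : ℝ

open ℂ public

infix  4 _≈_
infixl 6 _+_
infixl 7 _*_

_≈_ : Rel ℂ 0ℓ
z ≈ w = (re z ≃ re w) × (im z ≃ im w)

_+_ _*_ : ℂ → ℂ → ℂ
z + w = (re z +ᵣ re w) +i (im z +ᵣ im w)
z * w = (re z *ᵣ re w +ᵣ -ᵣ (im z *ᵣ im w)) +i
        (re z *ᵣ im w +ᵣ im z *ᵣ re w)

0ℂ : ℂ
0ℂ = fromℚ 0ℚ +i fromℚ 0ℚ

conj : ℂ → ℂ
conj z = re z +i (-ᵣ im z)

+-rawMonoid : RawMonoid 0ℓ 0ℓ
+-rawMonoid = record { Carrier = ℂ ; _≈_ = _≈_ ; _∙_ = _+_ ; ε = 0ℂ }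

open RawMonoidDefs +-rawMonoid public using (sum)

ℂ^ : ℕ → Set
ℂ^ d = Vector ℂ d

infix 4 _≈ᵛ_ _≈ᴹ_ _⊥ˢ_

_≈ᵛ_ : ∀ {d} → Rel (ℂ^ d) 0ℓ
x ≈ᵛ y = ∀ i → x i ≈ y i

0ᵛ : ∀ {d} → ℂ^ d
0ᵛ _ = 0ℂ

_+ᵛ_ : ∀ {d} → ℂ^ d → ℂ^ d → ℂ^ d
(x +ᵛ y) i = x i + y i

_*ᵛ_ : ∀ {d} → ℂ → ℂ^ d → ℂ^ d
(c *ᵛ x) i = c * x i

linComb : ∀ {r d} → (Fin r → ℂ) → (Fin r → ℂ^ d) → ℂ^ d
linComb c b i = sum (λ k → c k * b k i)

⟨_,_⟩ : ∀ {d} → ℂ^ d → ℂ^ d → ℂ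
⟨ x , y ⟩ = sum (λ i → conj (x i) * y i)

LinearlyIndependent : ∀ {r d} → (Fin r → ℂ^ d) → Set
LinearlyIndependent b = ∀ c → linComb c b ≈ᵛ 0ᵛ → ∀ k → c k ≈ 0ℂ

HasDimension : ∀ {d} → Pred (ℂ^ d) 0ℓ → ℕ → Set
HasDimension {d} S r = Σ[ b ∈ (Fin r → ℂ^ d) ]
  ((∀ k → S (b k)) ×
   LinearlyIndependent b ×
   (∀ x → S x → ∃[ c ] (x ≈ᵛ linComb c b)))

record Subspace (d : ℕ) : Set₁ where
  field
    _∋_      : Pred (ℂ^ d) 0ℓ
    resp     : ∀ {x y} → x ≈ᵛ y → _∋_ x → _∋_ y
    0-closed : _∋_ 0ᵛ
    +-closed : ∀ {x y} → _∋_ x → _∋_ y → _∋_ (x +ᵛ y)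
    *-closed : ∀ c {x} → _∋_ x → _∋_ (c *ᵛ x)

open Subspace public using (_∋_)

_⊥ˢ_ : ∀ {d} → Subspace d → Subspace d → Set
S ⊥ˢ T = ∀ x y → S ∋ x → T ∋ y → ⟨ x , y ⟩ ≈ 0ℂ

Matrix : ℕ → Set
Matrix d = Fin d → Fin d → ℂ

_≈ᴹ_ : ∀ {d} → Rel (Matrix d) 0ℓ
A ≈ᴹ B = ∀ i j → A i j ≈ B i j

0ᴹ : ∀ {d} → Matrix d
0ᴹ _ _ = 0ℂ

_*ᴹ_ : ∀ {d} → Matrix d → Matrix d → Matrix d
(A *ᴹ B) i j = sum (λ k → A i k * B k j)

_ᴴ : ∀ {d} → Matrix d → Matrix d
(A ᴴ) i j = conj (A j i)

_·_ : ∀ {d} → Matrix d → ℂ^ d → ℂ^ d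
(A · x) i = sum (λ j → A i j * x j)

ColumnSpace : ∀ {d} → Matrix d → Pred (ℂ^ d) 0ℓ
ColumnSpace A y = ∃[ x ] (y ≈ᵛ A · x)

HasRank : ∀ {d} → Matrix d → ℕ → Set
HasRank A r = HasDimension (ColumnSpace A) r

record Graph (n : ℕ) : Set₁ where
  field
    Adj         : Rel (Fin n) 0ℓ
    symmetric   : Symmetric Adj
    irreflexive : Irreflexive _≡_ Adj

open Graph public using (Adj)

complement : ∀ {n} → Graph n → Graph n
complement G = record
  { Adj         = λ u v → u ≢ v × ¬ Adj G u v
  ; symmetric   = λ (u≢v , ¬uv) →
      (λ v≡u → u≢v (sym v≡u)) , (λ vu → ¬uv (Graph.symmetric G vu))
  ; irreflexive = λ u≡v (u≢v , _) → u≢v u≡v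
  }

record ProjectiveRepresentation {n} (H : Graph n) (d r : ℕ) : Set where
  field
    r≤d        : r ℕ.≤ d
    P          : Fin n → Matrix d
    rank       : ∀ u → HasRank (P u) r
    hermitian  : ∀ u → ((P u) ᴴ) ≈ᴹ P u
    idempotent : ∀ u → (P u *ᴹ P u) ≈ᴹ P u
    orthogonal : ∀ u v → Adj H u v → (P u *ᴹ P v) ≈ᴹ 0ᴹ

ProjectiveRatio : ∀ {n} → Graph n → Pred ℚ 0ℓ
ProjectiveRatio H q = ∃[ d ] ∃[ r ] Σ[ r≢0 ∈ NonZero r ]
  (ProjectiveRepresentation H d r × q ≡ ℚ._/_ (+ d) r {{r≢0}})

-- "ξ_f(H) = x"
IsProjectiveRank : ∀ {n} → Graph n → ℝ → Set
IsProjectiveRank H x = IsInfimum (ProjectiveRatio H) x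

record FaithfulOrthogonalSubspaceRepresentation
       {n} (G : Graph n) (d r : ℕ) : Set₁ where
  field
    S         : Fin n → Subspace d
    dimension : ∀ u → HasDimension (S u ∋_) r
    faithful  : ∀ u v → u ≢ v → (S u ⊥ˢ S v) ⇔ (¬ Adj G u v)

-- "mr⁺_[r](G) = d"
IsMinPSDRank : ∀ {n} → Graph n → (r d : ℕ) → Set₁
IsMinPSDRank G r d =
  FaithfulOrthogonalSubspaceRepresentation G d r ×
  (∀ d′ → FaithfulOrthogonalSubspaceRepresentation G d′ r → d ℕ.≤ d′)

-- "mr⁺_f(G) = x".  The function mr gives mr⁺_[r](G) for r ≥ 1; in
-- particular each of these minima is required to exist.  Its value at
-- r = 0 is irrelevant.
IsFractionalMinPSDRank : ∀ {n} → Graph n → ℝ → Set₁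
IsFractionalMinPSDRank G x = Σ[ mr ∈ (ℕ → ℕ) ]
  ((∀ r → NonZero r → IsMinPSDRank G r (mr r)) ×
   IsInfimum (λ q → ∃[ r ] Σ[ r≢0 ∈ NonZero r ]
                      q ≡ ℚ._/_ (+ mr r) r {{r≢0}}) x)

{-# OPTIONS --safe #-}

-- A faithful (d;r) representation of G by subspaces yields a d/r-representation
-- of the complement: take the orthogonal projections onto the subspaces.
-- Conversely the images of a d/r-representation of the complement satisfy the
-- required orthogonality relations, but possibly some extra ones.  Adding a single
-- faithful representation by lines in ℂ^(n²) to the direct sum of k copies of
-- the images restores faithfulness, and the ratio (kd + n²)/(kr + 1) tends
-- to d/r.  So the two infima are over sets with the same lower bounds.

module Submission where

open import Algebra.Bundles using (CommutativeRing)
import Algebra.Properties.CommutativeMonoid.Sum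
import Algebra.Properties.CommutativeSemigroup
import Algebra.Properties.Group
import Algebra.Properties.Ring
import Algebra.Properties.Semiring.Sum
open import Axiom.ExcludedMiddle using (ExcludedMiddle)
open import Data.Bool.Base using (if_then_else_)
open import Data.Fin.Base using (Fin; zero; suc; punchIn; splitAt; _↑ˡ_; _↑ʳ_; combine; remQuot)
import Data.Fin.Properties as Fin
open import Data.Integer.Base as ℤ using (+_)
import Data.Integer.Properties as ℤ
open import Data.Nat.Base as ℕ using (ℕ; zero; suc; NonZero)
import Data.Nat.Properties as ℕ
import Data.Nat.Solver as ℕ
open import Data.Product.Base using (Σ-syntax; ∃-syntax; _×_; _,_; proj₁; proj₂)
open import Data.Rational.Base as ℚ using (ℚ; mkℚ; 0ℚ; 1ℚ; ½; ∣_∣)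
import Data.Rational.Properties as ℚ
open import Data.Rational.Solver using (module +-*-Solver)
import Data.Rational.Unnormalised.Base as ℚᵘ
import Data.Rational.Unnormalised.Properties as ℚᵘ
open import Data.Sum.Base using (_⊎_; inj₁; inj₂)
open import Data.Vec.Functional using (_∷_; []; _++_; insertAt)
open import Data.Vec.Functional.Properties
  using (insertAt-lookup; insertAt-punchIn; lookup-++ˡ; lookup-++ʳ)
open import Function.Base using (_∘_)
open import Function.Bundles using (mk⇔; Equivalence)
open import Level using (0ℓ; _⊔_; lift; lower) renaming (suc to lsuc)
open import Relation.Binary.PropositionalEquality as ≡ using (_≡_; _≢_)
import Relation.Binary.Reasoning.Setoid
open import Relation.Nullary using (¬_; Dec; does; yes; no; contradiction; ¬?)
open import Relation.Nullary.Decidable using (decidable-stable; map′)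
open import Relation.Unary using (Pred)

-- The obstacle is the word "faithful": moving the images slightly to break an unwanted
-- orthogonality could also break a required one. A direct summand avoids this. Orthogonality of two
-- direct sums forces orthogonality in every block, so one faithful block settles which pairs are
-- orthogonal, while the other blocks only have to satisfy the required relations. That block costs
-- 1 in rank and n² in ambient dimension whatever k is, and so disappears from the ratio as k grows.
-- Since real numbers are Cauchy sequences, excluded middle carries much of the analysis: it decides
-- whether a complex number is zero (in Gram-Schmidt and in the pivot search), bounds a nonzero real
-- away from 0, and yields the infimum. It also decides adjacency and finds the least ambient
-- dimension for each r.

↑-elim : ∀ m {n ℓ} {P : Fin (m ℕ.+ n) → Set ℓ} →
         (∀ i → P (i ↑ˡ n)) → (∀ j → P (m ↑ʳ j)) → ∀ k → P k
↑-elim m {n} {P = P} left right k with splitAt m k in eq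
... | inj₁ i = ≡.subst P (Fin.splitAt⁻¹-↑ˡ eq) (left i)
... | inj₂ j = ≡.subst P (Fin.splitAt⁻¹-↑ʳ eq) (right j)

-- The interface that Gram-Schmidt and elimination need; it hides the Cauchy sequences behind ℂ.
-- `definite` is an axiom about whole vectors because an abstract field has no order in which the
-- terms of the sum are nonnegative.
record InvolutiveField c ℓ : Set (lsuc (c ⊔ ℓ)) where
  field
    commutativeRing : CommutativeRing c ℓ
  open CommutativeRing commutativeRing public hiding (zero)
  open Algebra.Properties.CommutativeMonoid.Sum +-commutativeMonoid public
  field
    conj            : Carrier → Carrier
    conj-cong       : ∀ {x y} → x ≈ y → conj x ≈ conj y
    conj-+          : ∀ x y → conj (x + y) ≈ conj x + conj y
    conj-*          : ∀ x y → conj (x * y) ≈ conj x * conj y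
    conj-involutive : ∀ x → conj (conj x) ≈ x
    zero?           : ∀ x → Dec (x ≈ 0#)
    1≉0             : ¬ 1# ≈ 0#
    inverse         : ∀ x → ¬ x ≈ 0# → ∃[ y ] x * y ≈ 1#
    definite        : ∀ {d} (v : Fin d → Carrier) →
                      sum (λ i → conj (v i) * v i) ≈ 0# → ∀ i → v i ≈ 0#

-- Linear algebra over a field with a definite involution: sums, combinations and spans

module LinearAlgebra {c ℓ} (K : InvolutiveField c ℓ) where

  open InvolutiveField K
  open Algebra.Properties.Semiring.Sum semiring using (*-distribˡ-sum; *-distribʳ-sum)
  open Algebra.Properties.CommutativeSemigroup *-commutativeSemigroup using (x∙yz≈y∙xz; x∙yz≈z∙yx; interchange)
  open Algebra.Properties.Group +-group using (identityˡ-unique; x∙y⁻¹≈ε⇒x≈y)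
  open Algebra.Properties.Ring ring using (-‿distribˡ-*)
  open Relation.Binary.Reasoning.Setoid setoid

  infix  4 _≋_
  infixr 8 _·_

  V : ℕ → Set c
  V d = Fin d → Carrier

  Mat : ℕ → Set c
  Mat d = Fin d → Fin d → Carrier

  _≋_ : ∀ {d} → V d → V d → Set ℓ
  x ≋ y = ∀ i → x i ≈ y i

  0ⱽ : ∀ {d} → V d
  0ⱽ _ = 0#

  _+ⱽ_ : ∀ {d} → V d → V d → V d
  (x +ⱽ y) i = x i + y i

  linComb : ∀ {r d} → V r → (Fin r → V d) → V d
  linComb c b i = sum (λ k → c k * b k i)

  ⟨_,_⟩ : ∀ {d} → V d → V d → Carrier
  ⟨ x , y ⟩ = sum (λ i → conj (x i) * y i)

  _·_ : ∀ {d} → Mat d → V d → V d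
  (A · x) i = sum (λ j → A i j * x j)

  column : ∀ {d} → Mat d → Fin d → V d
  column A j i = A i j

  LinearlyIndependent : ∀ {r d} → (Fin r → V d) → Set (c ⊔ ℓ)
  LinearlyIndependent b = ∀ c → linComb c b ≋ 0ⱽ → c ≋ 0ⱽ

  Span : ∀ {r d} → (Fin r → V d) → V d → Set (c ⊔ ℓ)
  Span b x = ∃[ c ] (x ≋ linComb c b)

  sum-cong : ∀ {n} {f g : V n} → f ≋ g → sum f ≈ sum g
  sum-cong {_} {f} {g} = sum-cong-≋ {_} {f} {g}

  sum-zero : ∀ {n} {f : V n} → f ≋ 0ⱽ → sum f ≈ 0#
  sum-zero {n} f≋0 = trans (sum-cong f≋0) (sum-replicate-zero n)

  -- Associativity of a product row times matrix times column: distribute, exchange the two sums,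
  -- and collect. Associativity of combinations and self-adjointness are instances.
  sum-assoc : ∀ {m r} (c : V m) (e : Fin m → V r) (f : V r) →
              sum (λ j → c j * sum (λ k → e j k * f k)) ≈
              sum (λ k → sum (λ j → c j * e j k) * f k)
  sum-assoc c e f = begin
    sum (λ j → c j * sum (λ k → e j k * f k))    ≈⟨ sum-cong (λ j → *-distribˡ-sum (c j) (λ k → e j k * f k)) ⟩
    sum (λ j → sum (λ k → c j * (e j k * f k)))  ≈⟨ ∑-comm (λ j k → c j * (e j k * f k)) ⟩
    sum (λ k → sum (λ j → c j * (e j k * f k)))  ≈⟨ sum-cong (λ k → sum-cong (λ j → *-assoc (c j) (e j k) (f k))) ⟨
    sum (λ k → sum (λ j → c j * e j k * f k))    ≈⟨ sum-cong (λ k → *-distribʳ-sum (f k) (λ j → c j * e j k)) ⟨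
    sum (λ k → sum (λ j → c j * e j k) * f k)    ∎

  sum-↑ : ∀ m {n} (f : V (m ℕ.+ n)) →
          sum f ≈ sum (λ i → f (i ↑ˡ n)) + sum (λ j → f (m ↑ʳ j))
  sum-↑ zero    f = sym (+-identityˡ _)
  sum-↑ (suc m) f = trans (+-congˡ (sum-↑ m (f ∘ suc))) (sym (+-assoc _ _ _))

  -- Conjugation and the inner product

  conj-0 : conj 0# ≈ 0#
  conj-0 = identityˡ-unique (conj 0#) (conj 0#)
    (trans (sym (conj-+ 0# 0#)) (conj-cong (+-identityˡ 0#)))

  conj-1 : conj 1# ≈ 1#
  conj-1 = begin
    conj 1#                 ≈⟨ *-identityʳ (conj 1#) ⟨
    conj 1# * 1#            ≈⟨ *-congˡ (conj-involutive 1#) ⟨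
    conj 1# * conj (conj 1#) ≈⟨ conj-* 1# (conj 1#) ⟨
    conj (1# * conj 1#)     ≈⟨ conj-cong (*-identityˡ (conj 1#)) ⟩
    conj (conj 1#)          ≈⟨ conj-involutive 1# ⟩
    1#                      ∎

  conj-sum : ∀ {n} (f : V n) → conj (sum f) ≈ sum (λ i → conj (f i))
  conj-sum {zero}  f = conj-0
  conj-sum {suc n} f = trans (conj-+ _ _) (+-congˡ (conj-sum (f ∘ suc)))

  ⟨⟩-cong : ∀ {d} {x x′ y y′ : V d} → x ≋ x′ → y ≋ y′ → ⟨ x , y ⟩ ≈ ⟨ x′ , y′ ⟩
  ⟨⟩-cong x≋x′ y≋y′ = sum-cong λ i → *-cong (conj-cong (x≋x′ i)) (y≋y′ i)

  ⟨⟩-conj : ∀ {d} (x y : V d) → conj ⟨ x , y ⟩ ≈ ⟨ y , x ⟩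
  ⟨⟩-conj x y = trans (conj-sum (λ i → conj (x i) * y i)) (sum-cong λ i → begin
    conj (conj (x i) * y i)         ≈⟨ conj-* (conj (x i)) (y i) ⟩
    conj (conj (x i)) * conj (y i)  ≈⟨ *-congʳ (conj-involutive (x i)) ⟩
    x i * conj (y i)                ≈⟨ *-comm (x i) (conj (y i)) ⟩
    conj (y i) * x i                ∎)

  ⟨⟩-+ʳ : ∀ {d} (x y z : V d) → ⟨ x , y +ⱽ z ⟩ ≈ ⟨ x , y ⟩ + ⟨ x , z ⟩
  ⟨⟩-+ʳ x y z = trans (sum-cong λ i → distribˡ (conj (x i)) (y i) (z i))
    (∑-distrib-+ (λ i → conj (x i) * y i) (λ i → conj (x i) * z i))

  ⟨0,⟩ : ∀ {d} {x : V d} (y : V d) → x ≋ 0ⱽ → ⟨ x , y ⟩ ≈ 0#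
  ⟨0,⟩ {x = x} y x≋0 = sum-zero λ i → begin
    conj (x i) * y i  ≈⟨ *-congʳ (trans (conj-cong (x≋0 i)) conj-0) ⟩
    0# * y i          ≈⟨ zeroˡ (y i) ⟩
    0#                ∎

  ⟨,0⟩ : ∀ {d} (x : V d) {y : V d} → y ≋ 0ⱽ → ⟨ x , y ⟩ ≈ 0#
  ⟨,0⟩ x y≋0 = sum-zero λ i → trans (*-congˡ (y≋0 i)) (zeroʳ (conj (x i)))

  ·-cong : ∀ {d} (A : Mat d) {x y : V d} → x ≋ y → A · x ≋ A · y
  ·-cong A x≋y i = sum-cong λ j → *-congˡ (x≋y j)

  ·-+ : ∀ {d} (A : Mat d) (x y : V d) → A · (x +ⱽ y) ≋ (A · x) +ⱽ (A · y)
  ·-+ A x y i = trans (sum-cong λ j → distribˡ (A i j) (x j) (y j))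
    (∑-distrib-+ (λ j → A i j * x j) (λ j → A i j * y j))

  ·-linComb-columns : ∀ {d} (A : Mat d) (x : V d) → A · x ≋ linComb x (column A)
  ·-linComb-columns A x i = sum-cong λ j → *-comm (A i j) (x j)

  linComb-assoc : ∀ {m r d} (c : V m) (e : Fin m → V r) (b : Fin r → V d) →
                  linComb c (λ j → linComb (e j) b) ≋ linComb (linComb c e) b
  linComb-assoc c e b i = sum-assoc c e (λ k → b k i)

  ·-linComb : ∀ {r d} (A : Mat d) (c : V r) (b : Fin r → V d) →
              A · linComb c b ≋ linComb c (λ k → A · b k)
  ·-linComb A c b i = begin
    (A · linComb c b) i                              ≈⟨ ·-linComb-columns A (linComb c b) i ⟩
    linComb (linComb c b) (column A) i               ≈⟨ linComb-assoc c b (column A) i ⟨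
    linComb c (λ k → linComb (b k) (column A)) i     ≈⟨ sum-cong (λ k → *-congˡ (·-linComb-columns A (b k) i)) ⟨
    linComb c (λ k → A · b k) i                      ∎

  span-linComb : ∀ {m r d} {b : Fin r → V d} (c : V m) {a : Fin m → V d} →
                 (∀ j → Span b (a j)) → Span b (linComb c a)
  span-linComb {b = b} c a∈b = linComb c (proj₁ ∘ a∈b) , λ i →
    trans (sum-cong λ j → *-congˡ (proj₂ (a∈b j) i)) (linComb-assoc c (proj₁ ∘ a∈b) b i)

  linComb-+ : ∀ {r d} (c e : V r) (b : Fin r → V d) →
              linComb (c +ⱽ e) b ≋ linComb c b +ⱽ linComb e b
  linComb-+ c e b i = trans (sum-cong λ k → distribʳ (b k i) (c k) (e k))
    (∑-distrib-+ (λ k → c k * b k i) (λ k → e k * b k i))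

  linComb-* : ∀ {r d} a (c : V r) (b : Fin r → V d) →
              ∀ i → linComb (λ k → a * c k) b i ≈ a * linComb c b i
  linComb-* a c b i = trans (sum-cong λ k → *-assoc a (c k) (b k i))
    (sym (*-distribˡ-sum a (λ k → c k * b k i)))

  linComb-0 : ∀ {r d} (b : Fin r → V d) → linComb 0ⱽ b ≋ 0ⱽ
  linComb-0 b i = sum-zero λ k → zeroˡ (b k i)

  span-resp : ∀ {r d} (b : Fin r → V d) {x y : V d} → x ≋ y → Span b x → Span b y
  span-resp b x≋y (c , x≋) = c , λ i → trans (sym (x≋y i)) (x≋ i)

  span-0 : ∀ {r d} (b : Fin r → V d) → Span b 0ⱽ
  span-0 b = 0ⱽ , λ i → sym (linComb-0 b i)

  span-+ : ∀ {r d} (b : Fin r → V d) {x y : V d} → Span b x → Span b y → Span b (x +ⱽ y)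
  span-+ b (c , x≋) (e , y≋) = c +ⱽ e , λ i →
    trans (+-cong (x≋ i) (y≋ i)) (sym (linComb-+ c e b i))

  span-* : ∀ {r d} (b : Fin r → V d) a {x : V d} → Span b x → Span b (λ i → a * x i)
  span-* b a (c , x≋) = (λ k → a * c k) , λ i →
    trans (*-congˡ (x≋ i)) (sym (linComb-* a c b i))

  image⇒span : ∀ {d} (A : Mat d) y → ∃[ x ] (y ≋ A · x) → Span (column A) y
  image⇒span A y (x , y≋) = x , λ i → trans (y≋ i) (·-linComb-columns A x i)

  span⇒image : ∀ {d} (A : Mat d) y → Span (column A) y → ∃[ x ] (y ≋ A · x)
  span⇒image A y (x , y≋) = x , λ i → trans (y≋ i) (sym (·-linComb-columns A x i))

  IsHermitian : ∀ {d} → Mat d → Set ℓ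
  IsHermitian A = ∀ i j → conj (A j i) ≈ A i j

  self-adjoint : ∀ {d} (A : Mat d) → IsHermitian A → ∀ x y → ⟨ x , A · y ⟩ ≈ ⟨ A · x , y ⟩
  self-adjoint A A-herm x y = begin
    sum (λ i → conj (x i) * sum (λ j → A i j * y j))
      ≈⟨ sum-assoc (conj ∘ x) A y ⟩
    sum (λ j → sum (λ i → conj (x i) * A i j) * y j)
      ≈⟨ sum-cong (λ j → *-congʳ (sym (row j))) ⟩
    sum (λ j → conj (sum (λ i → A j i * x i)) * y j)
      ∎
    where
    row : ∀ j → conj (sum (λ i → A j i * x i)) ≈ sum (λ i → conj (x i) * A i j)
    row j = trans (conj-sum (λ i → A j i * x i)) (sum-cong λ i → begin
      conj (A j i * x i)         ≈⟨ conj-* (A j i) (x i) ⟩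
      conj (A j i) * conj (x i)  ≈⟨ *-congʳ (A-herm i j) ⟩
      A i j * conj (x i)         ≈⟨ *-comm (A i j) (conj (x i)) ⟩
      conj (x i) * A i j         ∎)

  -- Moving the hermitian A across the inner product turns ⟨Ac, Be⟩ into ⟨c, ABe⟩, and AB vanishes.
  images-orthogonal : ∀ {d} (A B : Mat d) → IsHermitian A →
    (∀ i j → sum (λ k → A i k * B k j) ≈ 0#) →
    ∀ x y → Span (column A) x → Span (column B) y → ⟨ x , y ⟩ ≈ 0#
  images-orthogonal A B A-herm AB≈0 x y x∈A y∈B
    with span⇒image A x x∈A | span⇒image B y y∈B
  ... | c , x≋ | e , y≋ = begin
    ⟨ x , y ⟩          ≈⟨ ⟨⟩-cong x≋ y≋ ⟩
    ⟨ A · c , B · e ⟩  ≈⟨ self-adjoint A A-herm c (B · e) ⟨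
    ⟨ c , A · B · e ⟩  ≈⟨ ⟨,0⟩ c AB·e≋0 ⟩
    0#                 ∎
    where
    AB·e≋0 : A · B · e ≋ 0ⱽ
    AB·e≋0 i = trans (sum-assoc (A i) B e)
      (sum-zero λ k → trans (*-congʳ (AB≈0 i k)) (zeroˡ (e k)))

  -- Orthogonal projections

  -- The fields are what the recursion on `b` can carry along. Idempotence follows from them: `P`
  -- fixes the span and its columns lie there.
  record Projection {r d} (b : Fin r → V d) : Set (c ⊔ ℓ) where
    field
      P         : Mat d
      hermitian : IsHermitian P
      fixes     : ∀ k → P · b k ≋ b k
      columns   : ∀ j → Span b (column P j)

    range : ∀ x → Span b (P · x)
    range x = proj₁ x∈b , λ i → trans (·-linComb-columns P x i) (proj₂ x∈b i)
      where
      x∈b : Span b (linComb x (column P))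
      x∈b = span-linComb x columns

    fixes-span : ∀ {x} → Span b x → P · x ≋ x
    fixes-span {x} (c , x≋) i = begin
      (P · x) i                    ≈⟨ ·-cong P x≋ i ⟩
      (P · linComb c b) i          ≈⟨ ·-linComb P c b i ⟩
      linComb c (λ k → P · b k) i  ≈⟨ sum-cong (λ k → *-congˡ (fixes k i)) ⟩
      linComb c b i                ≈⟨ x≋ i ⟨
      x i                          ∎

    image∋b : ∀ k → ∃[ x ] (b k ≋ P · x)
    image∋b k = b k , λ i → sym (fixes k i)

    image⊆span : ∀ y → ∃[ x ] (y ≋ P · x) → Span b y
    image⊆span y (x , y≋) = span-resp b (λ i → sym (y≋ i)) (range x)

    -- Entry (i, j) of the square is entry i of `P` applied to its own column j, a vector of the
    -- span and hence fixed.
    idempotent : ∀ i j → sum (λ k → P i k * P k j) ≈ P i j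
    idempotent i j = fixes-span (columns j) i

  -- One Gram-Schmidt step. The residue `w` of `b zero` is orthogonal to the span of the later
  -- vectors. If its norm vanishes, the old projection already fixes `b zero`; otherwise the
  -- projection onto the line of `w` is added. Dependent families are thus covered as well.
  module _ {r d} (b : Fin (suc r) → V d) (Q : Projection (b ∘ suc)) where

    private
      module Q = Projection Q

      w : V d
      w i = b zero i - (Q.P · b zero) i

      ww : Carrier
      ww = ⟨ w , w ⟩

      b₀≋ : b zero ≋ w +ⱽ (Q.P · b zero)
      b₀≋ i = begin
        b zero i                                           ≈⟨ +-identityʳ _ ⟨
        b zero i + 0#                                      ≈⟨ +-congˡ (-‿inverseˡ _) ⟨
        b zero i + (- (Q.P · b zero) i + (Q.P · b zero) i) ≈⟨ +-assoc _ _ _ ⟨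
        w i + (Q.P · b zero) i                             ∎

      -- Qw + Qb₀ = Qw + QQb₀ = Q(w + Qb₀) = Qb₀, and Qb₀ cancels.
      Q·w≋0 : Q.P · w ≋ 0ⱽ
      Q·w≋0 i = identityˡ-unique ((Q.P · w) i) ((Q.P · b zero) i) (begin
        (Q.P · w) i + (Q.P · b zero) i          ≈⟨ +-congˡ (Q.fixes-span (Q.range (b zero)) i) ⟨
        (Q.P · w) i + (Q.P · Q.P · b zero) i    ≈⟨ ·-+ Q.P w (Q.P · b zero) i ⟨
        (Q.P · (w +ⱽ (Q.P · b zero))) i         ≈⟨ ·-cong Q.P b₀≋ i ⟨
        (Q.P · b zero) i                        ∎)

      ⟨w,Q⟩≈0 : ∀ x → ⟨ w , Q.P · x ⟩ ≈ 0#
      ⟨w,Q⟩≈0 x = trans (self-adjoint Q.P Q.hermitian w x) (⟨0,⟩ x Q·w≋0)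

      ⟨w,b₀⟩ : ⟨ w , b zero ⟩ ≈ ww
      ⟨w,b₀⟩ = begin
        ⟨ w , b zero ⟩                      ≈⟨ ⟨⟩-cong (λ _ → refl) b₀≋ ⟩
        ⟨ w , w +ⱽ (Q.P · b zero) ⟩         ≈⟨ ⟨⟩-+ʳ w w (Q.P · b zero) ⟩
        ww + ⟨ w , Q.P · b zero ⟩    ≈⟨ +-congˡ (⟨w,Q⟩≈0 (b zero)) ⟩
        ww + 0#                      ≈⟨ +-identityʳ ww ⟩
        ww                           ∎

      ⟨w,bₖ⟩≈0 : ∀ k → ⟨ w , b (suc k) ⟩ ≈ 0#
      ⟨w,bₖ⟩≈0 k = trans (⟨⟩-cong (λ _ → refl) (λ i → sym (Q.fixes k i))) (⟨w,Q⟩≈0 (b (suc k)))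

      weaken : ∀ {x} → Span (b ∘ suc) x → Span b x
      weaken (c , x≋) = 0# ∷ c , λ i →
        trans (x≋ i) (sym (trans (+-congʳ (zeroˡ _)) (+-identityˡ _)))

    -- Definiteness gives w = 0, that is, `b zero` equals its own projection.
    extend-trivial : ww ≈ 0# → Projection b
    extend-trivial ww≈0 = record
      { P         = Q.P
      ; hermitian = Q.hermitian
      ; fixes     = λ { zero i    → sym (x∙y⁻¹≈ε⇒x≈y _ _ (definite w ww≈0 i))
                      ; (suc k) i → Q.fixes k i }
      ; columns   = weaken ∘ Q.columns
      }

    module _ (s : Carrier) (ww*s≈1 : ww * s ≈ 1#) where

      private
        -- Q + w w* / ⟨w,w⟩
        P : Mat d
        P i j = Q.P i j + w i * (s * conj (w j))

        -- `s` inverts the self-conjugate ⟨w, w⟩, so inserting this product on one side and removing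
        -- its conjugate on the other exchanges `conj s` and `s`.
        conj-s : conj s ≈ s
        conj-s = begin
          conj s                        ≈⟨ *-identityˡ (conj s) ⟨
          1# * conj s                   ≈⟨ *-congʳ ww*s≈1 ⟨
          ww * s * conj s        ≈⟨ *-assoc ww s (conj s) ⟩
          ww * (s * conj s)      ≈⟨ x∙yz≈y∙xz ww s (conj s) ⟩
          s * (ww * conj s)      ≈⟨ *-congˡ (*-congʳ (⟨⟩-conj w w)) ⟨
          s * (conj ww * conj s) ≈⟨ *-congˡ (conj-* ww s) ⟨
          s * conj (ww * s)      ≈⟨ *-congˡ (trans (conj-cong ww*s≈1) conj-1) ⟩
          s * 1#                        ≈⟨ *-identityʳ s ⟩
          s                             ∎

        P-hermitian : IsHermitian P
        P-hermitian i j = begin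
          conj (Q.P j i + w j * (s * conj (w i)))
            ≈⟨ conj-+ (Q.P j i) _ ⟩
          conj (Q.P j i) + conj (w j * (s * conj (w i)))
            ≈⟨ +-cong (Q.hermitian i j) (trans (conj-* (w j) _) (*-congˡ (conj-* s _))) ⟩
          Q.P i j + conj (w j) * (conj s * conj (conj (w i)))
            ≈⟨ +-congˡ (*-congˡ (*-cong conj-s (conj-involutive (w i)))) ⟩
          Q.P i j + conj (w j) * (s * w i)
            ≈⟨ +-congˡ (x∙yz≈z∙yx (conj (w j)) s (w i)) ⟩
          Q.P i j + w i * (s * conj (w j))
            ∎

        P· : ∀ x i → (P · x) i ≈ (Q.P · x) i + w i * (s * ⟨ w , x ⟩)
        P· x i = begin
          sum (λ j → (Q.P i j + w i * (s * conj (w j))) * x j)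
            ≈⟨ sum-cong (λ j → trans (distribʳ (x j) _ _)
                 (+-congˡ (trans (*-assoc (w i) _ (x j)) (*-congˡ (*-assoc s _ (x j)))))) ⟩
          sum (λ j → Q.P i j * x j + w i * (s * (conj (w j) * x j)))
            ≈⟨ ∑-distrib-+ (λ j → Q.P i j * x j) (λ j → w i * (s * (conj (w j) * x j))) ⟩
          (Q.P · x) i + sum (λ j → w i * (s * (conj (w j) * x j)))
            ≈⟨ +-congˡ (*-distribˡ-sum (w i) (λ j → s * (conj (w j) * x j))) ⟨
          (Q.P · x) i + w i * sum (λ j → s * (conj (w j) * x j))
            ≈⟨ +-congˡ (*-congˡ (*-distribˡ-sum s (λ j → conj (w j) * x j))) ⟨
          (Q.P · x) i + w i * (s * ⟨ w , x ⟩)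
            ∎

        P-fixes : ∀ k → P · b k ≋ b k
        P-fixes zero i = begin
          (P · b zero) i                                ≈⟨ P· (b zero) i ⟩
          (Q.P · b zero) i + w i * (s * ⟨ w , b zero ⟩) ≈⟨ +-congˡ (*-congˡ (*-congˡ ⟨w,b₀⟩)) ⟩
          (Q.P · b zero) i + w i * (s * ww)      ≈⟨ +-congˡ (*-congˡ (trans (*-comm s _) ww*s≈1)) ⟩
          (Q.P · b zero) i + w i * 1#                   ≈⟨ +-congˡ (*-identityʳ (w i)) ⟩
          (Q.P · b zero) i + w i                        ≈⟨ +-comm _ (w i) ⟩
          w i + (Q.P · b zero) i                        ≈⟨ b₀≋ i ⟨
          b zero i                                      ∎
        P-fixes (suc k) i = begin
          (P · b (suc k)) i                                   ≈⟨ P· (b (suc k)) i ⟩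
          (Q.P · b (suc k)) i + w i * (s * ⟨ w , b (suc k) ⟩)
            ≈⟨ +-cong (Q.fixes k i) (*-congˡ (*-congˡ (⟨w,bₖ⟩≈0 k))) ⟩
          b (suc k) i + w i * (s * 0#)                        ≈⟨ +-congˡ (trans (*-congˡ (zeroʳ s)) (zeroʳ (w i))) ⟩
          b (suc k) i + 0#                                    ≈⟨ +-identityʳ _ ⟩
          b (suc k) i                                         ∎

        w∈b : Span b w
        w∈b with Q.range (b zero)
        ... | e , Qb₀≋ = 1# ∷ (λ k → - e k) , λ i →
          +-cong (sym (*-identityˡ _)) (begin
            - (Q.P · b zero) i                    ≈⟨ -‿cong (Qb₀≋ i) ⟩
            - linComb e (b ∘ suc) i               ≈⟨ -1*x≈-x _ ⟨
            - 1# * linComb e (b ∘ suc) i          ≈⟨ *-distribˡ-sum (- 1#) (λ k → e k * b (suc k) i) ⟩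
            sum (λ k → - 1# * (e k * b (suc k) i)) ≈⟨ sum-cong (λ k → trans (-1*x≈-x _) (-‿distribˡ-* (e k) _)) ⟩
            linComb (λ k → - e k) (b ∘ suc) i     ∎)
          where open Algebra.Properties.Ring ring using (-1*x≈-x)

        P-columns : ∀ j → Span b (column P j)
        P-columns j = proj₁ Pⱼ∈b , λ i →
          trans (+-cong (sym (*-identityˡ (Q.P i j))) (trans (*-comm (w i) _) (sym (+-identityʳ _))))
                (proj₂ Pⱼ∈b i)
          where
          coefficients : V 2
          coefficients = 1# ∷ s * conj (w j) ∷ []
          vectors : Fin 2 → V d
          vectors = column Q.P j ∷ w ∷ []
          vectors∈b : ∀ k → Span b (vectors k)
          vectors∈b zero       = weaken (Q.columns j)
          vectors∈b (suc zero) = w∈b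
          Pⱼ∈b : Span b (linComb coefficients vectors)
          Pⱼ∈b = span-linComb {b = b} coefficients vectors∈b

      extend-orthogonal : Projection b
      extend-orthogonal = record
        { P = P ; hermitian = P-hermitian ; fixes = P-fixes ; columns = P-columns }

    extend : Projection b
    extend with zero? ww
    ... | yes ww≈0 = extend-trivial ww≈0
    ... | no ww≉0 with inverse ww ww≉0
    ... | s , ww*s≈1 = extend-orthogonal s ww*s≈1

  projection : ∀ {r d} (b : Fin r → V d) → Projection b
  projection {zero} b = record
    { P         = λ _ _ → 0#
    ; hermitian = λ _ _ → conj-0
    ; fixes     = λ ()
    ; columns   = λ _ → (λ ()) , λ _ → refl
    }
  projection {suc r} b = extend b (projection (b ∘ suc))

  -- As A is hermitian, entry (i, j) of AB is the inner product of column i of A with column j of B,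
  -- and these columns lie in the two spans.
  projections-orthogonal : ∀ {r r′ d} {b : Fin r → V d} {b′ : Fin r′ → V d}
    (A : Projection b) (B : Projection b′) →
    (∀ x y → Span b x → Span b′ y → ⟨ x , y ⟩ ≈ 0#) →
    ∀ i j → sum (λ k → Projection.P A i k * Projection.P B k j) ≈ 0#
  projections-orthogonal A B b⊥b′ i j = trans
    (sum-cong λ k → *-congʳ (sym (A.hermitian i k)))
    (b⊥b′ (column A.P i) (column B.P j) (A.columns i) (B.columns j))
    where
    module A = Projection A
    module B = Projection B

  -- Linear independence

  cancel-zero : ∀ {a x} → ¬ a ≈ 0# → x * a ≈ 0# → x ≈ 0#
  cancel-zero {a} {x} a≉0 xa≈0 with inverse a a≉0
  ... | a⁻¹ , aa⁻¹≈1 = begin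
    x              ≈⟨ *-identityʳ x ⟨
    x * 1#         ≈⟨ *-congˡ aa⁻¹≈1 ⟨
    x * (a * a⁻¹)  ≈⟨ *-assoc x a a⁻¹ ⟨
    x * a * a⁻¹    ≈⟨ *-congʳ xa≈0 ⟩
    0# * a⁻¹       ≈⟨ zeroˡ a⁻¹ ⟩
    0#             ∎

  -- One elimination step: the pivot is column j, coordinate zero.  Rows are
  -- scaled rather than divided by the pivot entry.
  module _ {r d} (b : Fin (suc r) → V (suc d)) (j : Fin (suc r)) where

    private
      eliminated : Fin r → V (suc d)
      eliminated k i = b j zero * b (punchIn j k) i + - b (punchIn j k) zero * b j i

      eliminated-zero : ∀ k → eliminated k zero ≈ 0#
      eliminated-zero k = begin
        b j zero * b (punchIn j k) zero + - b (punchIn j k) zero * b j zero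
          ≈⟨ +-congˡ (trans (sym (-‿distribˡ-* _ _)) (-‿cong (*-comm _ _))) ⟩
        b j zero * b (punchIn j k) zero - b j zero * b (punchIn j k) zero
          ≈⟨ -‿inverseʳ _ ⟩
        0#
          ∎

    eliminate : Fin r → V d
    eliminate k i = eliminated k (suc i)

    -- A relation `c` between the eliminated vectors lifts to one between the `b`: the coefficient
    -- of each other vector is multiplied by the pivot, and `e` collects what falls on vector `j`.
    -- Independence kills the multiplied coefficients, and the pivot is invertible.
    eliminate-independent : ¬ b j zero ≈ 0# → LinearlyIndependent b → LinearlyIndependent eliminate
    eliminate-independent pivot≉0 b-indep c c·w≋0 k = cancel-zero pivot≉0
      (trans (reflexive (≡.sym (insertAt-punchIn c′ j e k)))
             (b-indep (insertAt c′ j e) c″·b≋0 (punchIn j k)))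
      where
      c′ : V r
      c′ k = c k * b j zero

      e : Carrier
      e = sum (λ k → c k * - b (punchIn j k) zero)

      c·eliminated≋0 : linComb c eliminated ≋ 0ⱽ
      -- The hypothesis speaks of the remaining coordinates only; coordinate zero was cleared by the
      -- elimination.
      c·eliminated≋0 zero    = sum-zero λ k → trans (*-congˡ (eliminated-zero k)) (zeroʳ (c k))
      c·eliminated≋0 (suc i) = c·w≋0 i

      c″·b≋0 : linComb (insertAt c′ j e) b ≋ 0ⱽ
      c″·b≋0 i = begin
        linComb (insertAt c′ j e) b i
          ≈⟨ sum-remove {i = j} (λ k → insertAt c′ j e k * b k i) ⟩
        insertAt c′ j e j * b j i + sum (λ k → insertAt c′ j e (punchIn j k) * b (punchIn j k) i)
          ≈⟨ +-cong (*-congʳ (reflexive (insertAt-lookup c′ j e)))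
               (sum-cong λ k → *-congʳ (reflexive (insertAt-punchIn c′ j e k))) ⟩
        e * b j i + sum (λ k → c′ k * b (punchIn j k) i)
          ≈⟨ +-congʳ (*-distribʳ-sum (b j i) (λ k → c k * - b (punchIn j k) zero)) ⟩
        sum (λ k → c k * - b (punchIn j k) zero * b j i) + sum (λ k → c′ k * b (punchIn j k) i)
          ≈⟨ ∑-distrib-+ (λ k → c k * - b (punchIn j k) zero * b j i) (λ k → c′ k * b (punchIn j k) i) ⟨
        sum (λ k → c k * - b (punchIn j k) zero * b j i + c′ k * b (punchIn j k) i)
          ≈⟨ sum-cong (λ k → regroup (c k) (- b (punchIn j k) zero) (b j i) (b j zero) (b (punchIn j k) i)) ⟩
        linComb c eliminated i
          ≈⟨ c·eliminated≋0 i ⟩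
        0#
          ∎
        where
        regroup : ∀ x p q s t → x * p * q + x * s * t ≈ x * (s * t + p * q)
        regroup x p q s t = begin
          x * p * q + x * s * t      ≈⟨ +-cong (*-assoc x p q) (*-assoc x s t) ⟩
          x * (p * q) + x * (s * t)  ≈⟨ distribˡ x (p * q) (s * t) ⟨
          x * (p * q + s * t)        ≈⟨ *-congˡ (+-comm (p * q) (s * t)) ⟩
          x * (s * t + p * q)        ∎

  independent⇒≤ : ∀ {d r} (b : Fin r → V d) → LinearlyIndependent b → r ℕ.≤ d
  independent⇒≤ {_}     {zero}  b b-indep = ℕ.z≤n
  independent⇒≤ {zero}  {suc r} b b-indep = contradiction (b-indep (λ _ → 1#) (λ ()) zero) 1≉0
  independent⇒≤ {suc d} {suc r} b b-indep with Fin.any? (λ j → ¬? (zero? (b j zero)))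
  ... | yes (j , pivot≉0) = ℕ.s≤s
    (independent⇒≤ (eliminate b j) (eliminate-independent b j pivot≉0 b-indep))
  ... | no ¬pivot = ℕ.m≤n⇒m≤1+n (independent⇒≤ (λ k i → b k (suc i)) λ c c·b≋0 →
    b-indep c λ { zero    → sum-zero λ k → trans (*-congˡ (b₀≈0 k)) (zeroʳ (c k))
                ; (suc i) → c·b≋0 i })
    where
    b₀≈0 : ∀ k → b k zero ≈ 0#
    b₀≈0 k = decidable-stable (zero? (b k zero)) λ bₖ≉0 → ¬pivot (k , bₖ≉0)

  -- Direct sums

  infixr 5 _⊞_

  _⊞_ : ∀ {r r′ d d′} → (Fin r → V d) → (Fin r′ → V d′) → Fin (r ℕ.+ r′) → V (d ℕ.+ d′)
  b ⊞ b′ = (λ k → b k ++ 0ⱽ) ++ (λ l → 0ⱽ ++ b′ l)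

  module _ {r r′ d d′} (b : Fin r → V d) (b′ : Fin r′ → V d′) where

    private
      bˡ : Fin r → V (d ℕ.+ d′)
      bˡ k = b k ++ 0ⱽ
      bʳ : Fin r′ → V (d ℕ.+ d′)
      bʳ l = 0ⱽ ++ b′ l

      ⊞-lookupˡ : ∀ k → (b ⊞ b′) (k ↑ˡ r′) ≡ bˡ k
      ⊞-lookupˡ = lookup-++ˡ bˡ bʳ
      ⊞-lookupʳ : ∀ l → (b ⊞ b′) (r ↑ʳ l) ≡ bʳ l
      ⊞-lookupʳ = lookup-++ʳ bˡ bʳ

      at : ∀ {v v′ : V (d ℕ.+ d′)} {a} i → v ≡ v′ → v′ i ≡ a → v i ≈ a
      at i v≡v′ v′ᵢ≡a = reflexive (≡.trans (≡.cong (λ v → v i) v≡v′) v′ᵢ≡a)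

    linComb-⊞ˡ : ∀ e i → linComb e (b ⊞ b′) (i ↑ˡ d′) ≈ linComb (λ k → e (k ↑ˡ r′)) b i
    linComb-⊞ˡ e i = trans (sum-↑ r (λ k → e k * (b ⊞ b′) k (i ↑ˡ d′))) (trans
      (+-cong
        (sum-cong λ k → *-congˡ (at (i ↑ˡ d′) (⊞-lookupˡ k) (lookup-++ˡ (b k) 0ⱽ i)))
        (sum-zero λ l → trans (*-congˡ (at (i ↑ˡ d′) (⊞-lookupʳ l) (lookup-++ˡ 0ⱽ (b′ l) i)))
                              (zeroʳ (e (r ↑ʳ l)))))
      (+-identityʳ _))

    linComb-⊞ʳ : ∀ e i → linComb e (b ⊞ b′) (d ↑ʳ i) ≈ linComb (λ l → e (r ↑ʳ l)) b′ i
    linComb-⊞ʳ e i = trans (sum-↑ r (λ k → e k * (b ⊞ b′) k (d ↑ʳ i))) (trans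
      (+-cong
        (sum-zero λ k → trans (*-congˡ (at (d ↑ʳ i) (⊞-lookupˡ k) (lookup-++ʳ (b k) 0ⱽ i)))
                              (zeroʳ (e (k ↑ˡ r′))))
        (sum-cong λ l → *-congˡ (at (d ↑ʳ i) (⊞-lookupʳ l) (lookup-++ʳ {m = d} 0ⱽ (b′ l) i))))
      (+-identityˡ _))

    ⊞-independent : LinearlyIndependent b → LinearlyIndependent b′ → LinearlyIndependent (b ⊞ b′)
    ⊞-independent b-indep b′-indep e e·≋0 = ↑-elim r
      (b-indep (λ k → e (k ↑ˡ r′)) λ i → trans (sym (linComb-⊞ˡ e i)) (e·≋0 (i ↑ˡ d′)))
      (b′-indep (λ l → e (r ↑ʳ l)) λ i → trans (sym (linComb-⊞ʳ e i)) (e·≋0 (d ↑ʳ i)))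

    ⊞-span : ∀ x → Span b (λ i → x (i ↑ˡ d′)) → Span b′ (λ i → x (d ↑ʳ i)) → Span (b ⊞ b′) x
    ⊞-span x (e , x≋) (e′ , x′≋) = e ++ e′ , ↑-elim d
      (λ i → trans (x≋ i) (sym (trans (linComb-⊞ˡ (e ++ e′) i)
        (sum-cong λ k → *-congʳ (reflexive (lookup-++ˡ e e′ k))))))
      (λ i → trans (x′≋ i) (sym (trans (linComb-⊞ʳ (e ++ e′) i)
        (sum-cong λ l → *-congʳ (reflexive (lookup-++ʳ e e′ l))))))

    -- Each half of a vector of `b ⊞ b′` is an original vector or zero, but only up to lookup in an
    -- append; hence the demand that the predicates respect `≋`.
    ⊞-member : ∀ {p} {S : V d → Set p} {T : V d′ → Set p} →
               (∀ {x y} → x ≋ y → S x → S y) → (∀ {x y} → x ≋ y → T x → T y) →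
               S 0ⱽ → T 0ⱽ → (∀ k → S (b k)) → (∀ l → T (b′ l)) →
               ∀ k → S (λ i → (b ⊞ b′) k (i ↑ˡ d′)) × T (λ i → (b ⊞ b′) k (d ↑ʳ i))
    ⊞-member S-resp T-resp S0 T0 Sb Tb′ = ↑-elim r
      (λ k → S-resp (λ i → sym (at (i ↑ˡ d′) (⊞-lookupˡ k) (lookup-++ˡ (b k) 0ⱽ i))) (Sb k)
           , T-resp (λ i → sym (at (d ↑ʳ i) (⊞-lookupˡ k) (lookup-++ʳ (b k) 0ⱽ i))) T0)
      (λ l → S-resp (λ i → sym (at (i ↑ˡ d′) (⊞-lookupʳ l) (lookup-++ˡ 0ⱽ (b′ l) i))) S0
           , T-resp (λ i → sym (at (d ↑ʳ i) (⊞-lookupʳ l) (lookup-++ʳ {m = d} 0ⱽ (b′ l) i))) (Tb′ l))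

  ⟨0++,⟩ : ∀ {d d′} (x y : V d′) → ⟨ 0ⱽ {d} ++ x , 0ⱽ {d} ++ y ⟩ ≈ ⟨ x , y ⟩
  ⟨0++,⟩ {d} x y = trans (sum-↑ d (λ i → conj ((0ⱽ {d} ++ x) i) * (0ⱽ {d} ++ y) i)) (trans
    (+-cong
      (⟨0,⟩ _ (λ i → reflexive (lookup-++ˡ (0ⱽ {d}) x i)))
      (⟨⟩-cong (λ i → reflexive (lookup-++ʳ (0ⱽ {d}) x i)) (λ i → reflexive (lookup-++ʳ (0ⱽ {d}) y i))))
    (+-identityˡ _))

  span∋single : ∀ {d} (x : V d) → Span (λ (_ : Fin 1) → x) x
  span∋single x = (λ _ → 1#) , λ i → sym (trans (+-identityʳ _) (*-identityˡ (x i)))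

  single-independent : ∀ {d} (x : V d) i → x i ≈ 1# → LinearlyIndependent (λ (_ : Fin 1) → x)
  single-independent x i xᵢ≈1 c c·x≋0 zero = begin
    c zero              ≈⟨ *-identityʳ (c zero) ⟨
    c zero * 1#         ≈⟨ *-congˡ xᵢ≈1 ⟨
    c zero * x i        ≈⟨ +-identityʳ _ ⟨
    c zero * x i + 0#   ≈⟨ c·x≋0 i ⟩
    0#                  ∎

  -- Indicator vectors

  indicator : ∀ {p} {A : Set p} → Dec A → Carrier
  indicator A? = if does A? then 1# else 0#

  indicator-true : ∀ {p} {A : Set p} (A? : Dec A) → A → indicator A? ≈ 1#
  indicator-true (yes _) _ = refl
  indicator-true (no ¬a) a = contradiction a ¬a

  indicator-false : ∀ {p} {A : Set p} (A? : Dec A) → ¬ A → indicator A? ≈ 0#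
  indicator-false (yes a) ¬a = contradiction a ¬a
  indicator-false (no _)  _  = refl

  conj-indicator : ∀ {p} {A : Set p} (A? : Dec A) → conj (indicator A?) ≈ indicator A?
  conj-indicator (yes _) = conj-1
  conj-indicator (no _)  = conj-0

  indicator-idem : ∀ {p} {A : Set p} (A? : Dec A) → indicator A? * indicator A? ≈ indicator A?
  indicator-idem (yes _) = *-identityˡ 1#
  indicator-idem (no _)  = zeroˡ 0#

  module _ {p d} {A B : Fin d → Set p} (A? : ∀ i → Dec (A i)) (B? : ∀ i → Dec (B i)) where

    private
      both : V d
      both i = indicator (A? i) * indicator (B? i)

    -- ⟨ 1_A , 1_B ⟩ is the squared norm of 1_{A∩B}, so definiteness applies.
    indicators-overlap : ∀ i → A i → B i →
      ¬ ⟨ (λ i → indicator (A? i)) , (λ i → indicator (B? i)) ⟩ ≈ 0#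
    indicators-overlap i a b AB≈0 = 1≉0 (begin
      1#       ≈⟨ *-identityˡ 1# ⟨
      1# * 1#  ≈⟨ *-cong (indicator-true (A? i) a) (indicator-true (B? i) b) ⟨
      both i   ≈⟨ definite both (trans (sum-cong square) AB≈0) i ⟩
      0#       ∎)
      where
      square : ∀ i → conj (both i) * both i ≈ conj (indicator (A? i)) * indicator (B? i)
      square i = begin
        conj (both i) * both i
          ≈⟨ *-congʳ (trans (conj-* _ _) (*-cong (conj-indicator (A? i)) (conj-indicator (B? i)))) ⟩
        both i * both i
          ≈⟨ interchange _ _ _ _ ⟩
        (indicator (A? i) * indicator (A? i)) * (indicator (B? i) * indicator (B? i))
          ≈⟨ *-cong (indicator-idem (A? i)) (indicator-idem (B? i)) ⟩
        indicator (A? i) * indicator (B? i)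
          ≈⟨ *-congʳ (conj-indicator (A? i)) ⟨
        conj (indicator (A? i)) * indicator (B? i)
          ∎

    -- Each coordinate lies outside one of the two supports, so every term of the inner product has
    -- a vanishing factor, whatever the scalars.
    indicators-disjoint : (∀ i → A i → ¬ B i) → ∀ x y →
      Span {1} (λ _ i → indicator (A? i)) x → Span {1} (λ _ i → indicator (B? i)) y → ⟨ x , y ⟩ ≈ 0#
    indicators-disjoint disjoint x y (e , x≋) (e′ , y≋) = sum-zero λ i → term i (A? i) (x≋ i) (y≋ i)
      where
      vanish : ∀ {a z} c → a ≈ c * z + 0# → z ≈ 0# → a ≈ 0#
      vanish c a≈ z≈0 = trans a≈ (trans (+-identityʳ _) (trans (*-congˡ z≈0) (zeroʳ c)))

      term : ∀ i (a? : Dec (A i)) → x i ≈ e zero * indicator a? + 0# →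
             y i ≈ e′ zero * indicator (B? i) + 0# → conj (x i) * y i ≈ 0#
      term i (yes a) _ yᵢ≈ = trans (*-congˡ (vanish _ yᵢ≈ (indicator-false (B? i) (disjoint i a)))) (zeroʳ _)
      term i (no _) xᵢ≈ _ = trans (*-congʳ (trans (conj-cong (vanish _ xᵢ≈ refl)) conj-0)) (zeroˡ _)

open ≡ using (refl; sym; trans; cong; cong₂; subst; subst₂)
open import Defs

-- Null sequences

-- `x ≃ y` unfolds to nullity of the termwise difference, so closure properties of null sequences
-- are congruence laws of ℝ.
IsNull : (ℕ → ℚ) → Set
IsNull s = ∀ ε → 0ℚ ℚ.< ε → ∃[ N ] (∀ n → N ℕ.≤ n → ∣ s n ∣ ℚ.< ε)

null-cong : ∀ {s t} → (∀ n → s n ≡ t n) → IsNull s → IsNull t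
null-cong s≡t s→0 ε 0<ε with s→0 ε 0<ε
... | N , h = N , λ n N≤n → subst (λ q → ∣ q ∣ ℚ.< ε) (s≡t n) (h n N≤n)

null-0 : IsNull (λ _ → 0ℚ)
null-0 ε 0<ε = 0 , λ _ _ → 0<ε

null-dominated : ∀ {s t} → (∀ n → ∣ s n ∣ ℚ.≤ ∣ t n ∣) → IsNull t → IsNull s
null-dominated s≤t t→0 ε 0<ε with t→0 ε 0<ε
... | N , h = N , λ n N≤n → ℚ.≤-<-trans (s≤t n) (h n N≤n)

null-neg : ∀ {s} → IsNull s → IsNull (λ n → ℚ.- s n)
null-neg {s} = null-dominated (λ n → ℚ.≤-reflexive (ℚ.∣-p∣≡∣p∣ (s n)))

null-+ : ∀ {s t} → IsNull s → IsNull t → IsNull (λ n → s n ℚ.+ t n)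
null-+ {s} {t} s→0 t→0 ε 0<ε
  with s→0 (ε ℚ.* ½) (half-pos 0<ε) | t→0 (ε ℚ.* ½) (half-pos 0<ε)
... | M , hs | N , ht = M ℕ.⊔ N , λ n M⊔N≤n → begin-strict
  ∣ s n ℚ.+ t n ∣         ≤⟨ ℚ.∣p+q∣≤∣p∣+∣q∣ (s n) (t n) ⟩
  ∣ s n ∣ ℚ.+ ∣ t n ∣     <⟨ ℚ.+-mono-< (hs n (ℕ.m⊔n≤o⇒m≤o M N M⊔N≤n))
                                        (ht n (ℕ.m⊔n≤o⇒n≤o M N M⊔N≤n)) ⟩
  ε ℚ.* ½ ℚ.+ ε ℚ.* ½     ≡⟨ halves ε ⟩
  ε                       ∎
  where open ℚ.≤-Reasoning

null-* : ∀ {s t} → IsCauchy s → IsNull t → IsNull (λ n → s n ℚ.* t n)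
null-* {s} {t} s-cauchy t→0 ε 0<ε with eventually-bounded s s-cauchy
... | B , 0<B , M , s≤B with scale-down 0<B 0<ε
... | δ , 0<δ , Bδ≡ε with t→0 δ 0<δ
... | N , ht = M ℕ.⊔ N , λ n M⊔N≤n → subst (∣ s n ℚ.* t n ∣ ℚ.<_) Bδ≡ε
  (*-bound {a = s n} 0<B (s≤B n (ℕ.m⊔n≤o⇒m≤o M N M⊔N≤n))
                         (ht n (ℕ.m⊔n≤o⇒n≤o M N M⊔N≤n)))

square-nonneg : ∀ q → 0ℚ ℚ.≤ q ℚ.* q
square-nonneg q with ℚ.≤-total 0ℚ q
... | inj₁ 0≤q = ℚ.nonNegative⁻¹ (q ℚ.* q)
  {{ℚ.nonNeg*nonNeg⇒nonNeg q {{ℚ.nonNegative 0≤q}} q {{ℚ.nonNegative 0≤q}}}}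
... | inj₂ q≤0 = ℚ.nonNegative⁻¹ (q ℚ.* q)
  {{ℚ.nonPos*nonPos⇒nonPos q {{ℚ.nonPositive q≤0}} q {{ℚ.nonPositive q≤0}}}}

+-nonneg : ∀ {p q} → 0ℚ ℚ.≤ p → 0ℚ ℚ.≤ q → 0ℚ ℚ.≤ p ℚ.+ q
+-nonneg = ℚ.+-mono-≤

null-+-nonnegˡ : ∀ {s t : ℕ → ℚ} → (∀ n → 0ℚ ℚ.≤ s n) → (∀ n → 0ℚ ℚ.≤ t n) →
                 IsNull (λ n → s n ℚ.+ t n) → IsNull s
null-+-nonnegˡ {s} {t} 0≤s 0≤t = null-dominated {s} λ n → begin
  ∣ s n ∣          ≡⟨ ℚ.0≤p⇒∣p∣≡p (0≤s n) ⟩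
  s n              ≡⟨ ℚ.+-identityʳ (s n) ⟨
  s n ℚ.+ 0ℚ       ≤⟨ ℚ.+-monoʳ-≤ (s n) (0≤t n) ⟩
  s n ℚ.+ t n      ≡⟨ ℚ.0≤p⇒∣p∣≡p (+-nonneg (0≤s n) (0≤t n)) ⟨
  ∣ s n ℚ.+ t n ∣  ∎
  where open ℚ.≤-Reasoning

null-+-nonnegʳ : ∀ {s t : ℕ → ℚ} → (∀ n → 0ℚ ℚ.≤ s n) → (∀ n → 0ℚ ℚ.≤ t n) →
                 IsNull (λ n → s n ℚ.+ t n) → IsNull t
null-+-nonnegʳ {s} {t} 0≤s 0≤t st→0 = null-+-nonnegˡ {t} {s} 0≤t 0≤s
  (null-cong (λ n → ℚ.+-comm (s n) (t n)) st→0)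

-- The tolerance for the squares is ε²: a term of size at least ε would have a square of size at
-- least ε².
null-square : ∀ {s} → IsNull (λ n → s n ℚ.* s n) → IsNull s
null-square {s} ss→0 ε 0<ε with ss→0 (ε ℚ.* ε) 0<εε
  where
  0<εε : 0ℚ ℚ.< ε ℚ.* ε
  0<εε = ℚ.positive⁻¹ (ε ℚ.* ε)
    {{ℚ.pos*pos⇒pos ε {{ℚ.positive 0<ε}} ε {{ℚ.positive 0<ε}}}}
... | N , h = N , λ n N≤n → ℚ.≰⇒> λ ε≤s → ℚ.<-irrefl refl (begin-strict
  ε ℚ.* ε              ≤⟨ ℚ.*-monoˡ-≤-nonNeg ε {{ε-nonneg}} ε≤s ⟩
  ε ℚ.* ∣ s n ∣        ≤⟨ ℚ.*-monoʳ-≤-nonNeg ∣ s n ∣ {{ℚ.∣-∣-nonNeg (s n)}} ε≤s ⟩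
  ∣ s n ∣ ℚ.* ∣ s n ∣  ≡⟨ ℚ.∣p*q∣≡∣p∣*∣q∣ (s n) (s n) ⟨
  ∣ s n ℚ.* s n ∣      <⟨ h n N≤n ⟩
  ε ℚ.* ε              ∎)
  where
  open ℚ.≤-Reasoning
  ε-nonneg : ℚ.NonNegative ε
  ε-nonneg = ℚ.nonNegative (ℚ.<⇒≤ 0<ε)

-- Congruence and inverses of real numbers

-- Reduces the ring laws of ℝ and ℂ to identities in ℚ, term by term, where the ring solver applies.
≃-pointwise : ∀ x y → (∀ n → seq x n ≡ seq y n) → x ≃ y
≃-pointwise x y x≡y = null-cong (λ n → sym (p≡q⇒p-q≡0 (x≡y n))) null-0
  where
  p≡q⇒p-q≡0 : ∀ {p q} → p ≡ q → p ℚ.- q ≡ 0ℚ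
  p≡q⇒p-q≡0 {p} refl = ℚ.+-inverseʳ p

≃-sym : ∀ x y → x ≃ y → y ≃ x
≃-sym x y x≃y = null-cong (λ n → negate (seq x n) (seq y n)) (null-neg x≃y)
  where
  open +-*-Solver
  negate : ∀ a b → ℚ.- (a ℚ.- b) ≡ b ℚ.- a
  negate = solve 2 (λ a b → :- (a :- b) := b :- a) refl

≃-trans : ∀ x y z → x ≃ y → y ≃ z → x ≃ z
≃-trans x y z x≃y y≃z =
  null-cong (λ n → telescope (seq x n) (seq y n) (seq z n)) (null-+ x≃y y≃z)
  where
  open +-*-Solver
  telescope : ∀ a b c → (a ℚ.- b) ℚ.+ (b ℚ.- c) ≡ a ℚ.- c
  telescope = solve 3 (λ a b c → (a :- b) :+ (b :- c) := a :- c) refl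

+ᵣ-cong : ∀ x x′ y y′ → x ≃ x′ → y ≃ y′ → x +ᵣ y ≃ x′ +ᵣ y′
+ᵣ-cong x x′ y y′ x≃x′ y≃y′ = null-cong
  (λ n → rearrange (seq x n) (seq x′ n) (seq y n) (seq y′ n)) (null-+ x≃x′ y≃y′)
  where
  open +-*-Solver
  rearrange : ∀ a a′ b b′ → (a ℚ.- a′) ℚ.+ (b ℚ.- b′) ≡ (a ℚ.+ b) ℚ.- (a′ ℚ.+ b′)
  rearrange = solve 4 (λ a a′ b b′ →
    (a :- a′) :+ (b :- b′) := (a :+ b) :- (a′ :+ b′)) refl

-ᵣ-cong : ∀ x x′ → x ≃ x′ → -ᵣ x ≃ -ᵣ x′
-ᵣ-cong x x′ x≃x′ = null-cong (λ n → negate (seq x n) (seq x′ n)) (null-neg x≃x′)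
  where
  open +-*-Solver
  negate : ∀ a b → ℚ.- (a ℚ.- b) ≡ ℚ.- a ℚ.- (ℚ.- b)
  negate = solve 2 (λ a b → :- (a :- b) := :- a :- (:- b)) refl

*ᵣ-cong : ∀ x x′ y y′ → x ≃ x′ → y ≃ y′ → x *ᵣ y ≃ x′ *ᵣ y′
*ᵣ-cong x x′ y y′ x≃x′ y≃y′ = null-cong
  (λ n → rearrange (seq x n) (seq x′ n) (seq y n) (seq y′ n))
  (null-+ (null-* {s = seq x} (cauchy x) y≃y′) (null-* {s = seq y′} (cauchy y′) x≃x′))
  where
  open +-*-Solver
  rearrange : ∀ a a′ b b′ →
    a ℚ.* (b ℚ.- b′) ℚ.+ b′ ℚ.* (a ℚ.- a′) ≡ a ℚ.* b ℚ.- a′ ℚ.* b′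
  rearrange = solve 4 (λ a a′ b b′ →
    a :* (b :- b′) :+ b′ :* (a :- a′) := a :* b :- a′ :* b′) refl

BoundedAway : ℝ → Set
BoundedAway x = ∃[ ε ] (0ℚ ℚ.< ε × ∃[ N ] (∀ n → N ℕ.≤ n → ε ℚ.≤ ∣ seq x n ∣))

-- Once all terms differ by less than ε/2, a single later term of size at least ε keeps every later
-- term at size at least ε/2. If this never happens for any ε, the sequence is null.
boundedAway : ExcludedMiddle 0ℓ → ∀ x → ¬ IsNull (seq x) → BoundedAway x
boundedAway em x x≄0 with em {BoundedAway x}
... | yes away = away
... | no ¬away = contradiction x→0 x≄0
  where
  open ℚ.≤-Reasoning
  open +-*-Solver
  x→0 : IsNull (seq x)
  x→0 ε 0<ε with cauchy x (ε ℚ.* ½) (half-pos 0<ε)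
  ... | N , h = N , λ n N≤n → ℚ.≰⇒> λ ε≤xₙ →
    ¬away (ε ℚ.* ½ , half-pos 0<ε , N , λ m N≤m → ℚ.≮⇒≥ λ xₘ<ε/2 →
      ℚ.<-irrefl refl (begin-strict
        ε                                        ≤⟨ ε≤xₙ ⟩
        ∣ seq x n ∣                              ≡⟨ cong ∣_∣ (split (seq x n) (seq x m)) ⟩
        ∣ (seq x n ℚ.- seq x m) ℚ.+ seq x m ∣    ≤⟨ ℚ.∣p+q∣≤∣p∣+∣q∣ (seq x n ℚ.- seq x m) (seq x m) ⟩
        ∣ seq x n ℚ.- seq x m ∣ ℚ.+ ∣ seq x m ∣  <⟨ ℚ.+-mono-< (h n m N≤n N≤m) xₘ<ε/2 ⟩
        ε ℚ.* ½ ℚ.+ ε ℚ.* ½                      ≡⟨ halves ε ⟩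
        ε                                        ∎))
    where
    split : ∀ a b → a ≡ (a ℚ.- b) ℚ.+ b
    split = solve 2 (λ a b → a := (a :- b) :+ b) refl

-- The default 0 makes the inverse total: a sequence with nonzero limit may still have vanishing
-- early terms.
inv : ℚ → ℚ
inv q with q ℚ.≟ 0ℚ
... | yes _  = 0ℚ
... | no q≢0 = (ℚ.1/ q) {{ℚ.≢-nonZero q≢0}}

inv-inverseʳ : ∀ {q} → q ≢ 0ℚ → q ℚ.* inv q ≡ 1ℚ
inv-inverseʳ {q} q≢0 with q ℚ.≟ 0ℚ
... | yes q≡0 = contradiction q≡0 q≢0
... | no q≢0′ = ℚ.*-inverseʳ q {{ℚ.≢-nonZero q≢0′}}

inverseᵣ : ExcludedMiddle 0ℓ → ∀ x → ¬ IsNull (seq x) → ∃[ y ] (x *ᵣ y ≃ fromℚ 1ℚ)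
inverseᵣ em x x≄0 with boundedAway em x x≄0
... | ε , 0<ε , N , ε≤x with scale-down 0<ε (ℚ.positive⁻¹ 1ℚ)
-- `B` is 1/ε, a bound for the inverted terms from `N` on.
... | B , 0<B , εB≡1 = mkℝ y y-cauchy , xy≃1
  where
  open ℚ.≤-Reasoning
  open +-*-Solver

  y : ℕ → ℚ
  y n = inv (seq x n)

  xy≡1 : ∀ n → N ℕ.≤ n → seq x n ℚ.* y n ≡ 1ℚ
  xy≡1 n N≤n = inv-inverseʳ λ xₙ≡0 →
    ℚ.<-irrefl refl (ℚ.<-≤-trans 0<ε (subst (λ q → ε ℚ.≤ ∣ q ∣) xₙ≡0 (ε≤x n N≤n)))

  y≤B : ∀ n → N ℕ.≤ n → ∣ y n ∣ ℚ.≤ B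
  y≤B n N≤n = ℚ.*-cancelˡ-≤-pos ε {{ℚ.positive 0<ε}} (begin
    ε ℚ.* ∣ y n ∣            ≤⟨ ℚ.*-monoʳ-≤-nonNeg ∣ y n ∣ {{ℚ.∣-∣-nonNeg (y n)}} (ε≤x n N≤n) ⟩
    ∣ seq x n ∣ ℚ.* ∣ y n ∣  ≡⟨ ℚ.∣p*q∣≡∣p∣*∣q∣ (seq x n) (y n) ⟨
    ∣ seq x n ℚ.* y n ∣      ≡⟨ cong ∣_∣ (xy≡1 n N≤n) ⟩
    1ℚ                       ≡⟨ εB≡1 ⟨
    ε ℚ.* B                  ∎)

  -- The identity 1/a - 1/b = (b - a)/(ab), which makes the inverted sequence Cauchy.
  difference : ∀ {a a′ b b′} → a ℚ.* a′ ≡ 1ℚ → b ℚ.* b′ ≡ 1ℚ →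
               a′ ℚ.- b′ ≡ a′ ℚ.* (b′ ℚ.* (b ℚ.- a))
  difference {a} {a′} {b} {b′} aa′≡1 bb′≡1 = begin-equality
    a′ ℚ.- b′                                      ≡⟨ units a′ b′ ⟩
    a′ ℚ.* 1ℚ ℚ.- b′ ℚ.* 1ℚ                        ≡⟨ cong₂ (λ s t → a′ ℚ.* s ℚ.- b′ ℚ.* t) bb′≡1 aa′≡1 ⟨
    a′ ℚ.* (b ℚ.* b′) ℚ.- b′ ℚ.* (a ℚ.* a′)        ≡⟨ factor a a′ b b′ ⟩
    a′ ℚ.* (b′ ℚ.* (b ℚ.- a))                      ∎
    where
    units : ∀ a′ b′ → a′ ℚ.- b′ ≡ a′ ℚ.* 1ℚ ℚ.- b′ ℚ.* 1ℚ
    units = solve 2 (λ a′ b′ → a′ :- b′ := a′ :* con 1ℚ :- b′ :* con 1ℚ) refl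
    factor : ∀ a a′ b b′ → a′ ℚ.* (b ℚ.* b′) ℚ.- b′ ℚ.* (a ℚ.* a′) ≡
                           a′ ℚ.* (b′ ℚ.* (b ℚ.- a))
    factor = solve 4 (λ a a′ b b′ → a′ :* (b :* b′) :- b′ :* (a :* a′) :=
                                    a′ :* (b′ :* (b :- a))) refl

  y-cauchy : IsCauchy y
  -- Dividing by `B` twice gives δ with B²δ = η, as both inverses in `difference` are bounded by
  -- `B`.
  y-cauchy η 0<η with scale-down 0<B 0<η
  ... | η′ , 0<η′ , Bη′≡η with scale-down 0<B 0<η′
  ... | δ , 0<δ , Bδ≡η′ with cauchy x δ 0<δ
  ... | M , h = N ℕ.⊔ M , λ m n hm hn →
    let N≤m = ℕ.m⊔n≤o⇒m≤o N M hm
        N≤n = ℕ.m⊔n≤o⇒m≤o N M hn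
        x-close = h n m (ℕ.m⊔n≤o⇒n≤o N M hn) (ℕ.m⊔n≤o⇒n≤o N M hm)
    in begin-strict
    ∣ y m ℚ.- y n ∣
      ≡⟨ cong ∣_∣ (difference {seq x m} {y m} {seq x n} {y n} (xy≡1 m N≤m) (xy≡1 n N≤n)) ⟩
    ∣ y m ℚ.* (y n ℚ.* (seq x n ℚ.- seq x m)) ∣
      <⟨ *-bound {a = y m} 0<B (y≤B m N≤m)
           (*-bound {a = y n} 0<B (y≤B n N≤n) x-close) ⟩
    B ℚ.* (B ℚ.* δ)  ≡⟨ cong (B ℚ.*_) Bδ≡η′ ⟩
    B ℚ.* η′         ≡⟨ Bη′≡η ⟩
    η                ∎

  xy≃1 : x *ᵣ mkℝ y y-cauchy ≃ fromℚ 1ℚ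
  xy≃1 η 0<η = N , λ n N≤n →
    subst (λ q → ∣ q ℚ.- 1ℚ ∣ ℚ.< η) (sym (xy≡1 n N≤n)) 0<η

-- Fractions of natural numbers

infixl 7 _/ᴺ_

_/ᴺ_ : ∀ (a b : ℕ) .{{_ : NonZero b}} → ℚ
a /ᴺ b = ℚ._/_ (+ a) b

-- Division in ℚ reduces to lowest terms; in the unnormalised rationals comparison is plain
-- cross-multiplication, so the order lemmas pass through them.
toℚᵘ-/ᴺ : ∀ a b .{{_ : NonZero b}} → ℚ.toℚᵘ (a /ᴺ b) ℚᵘ.≃ (+ a ℚᵘ./ b)
toℚᵘ-/ᴺ a b@(suc b-1) = ℚ.toℚᵘ-fromℚᵘ (ℚᵘ.mkℚᵘ (+ a) b-1)

/ᴺ-mono-≤ : ∀ a b c d .{{_ : NonZero b}} .{{_ : NonZero d}} →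
            a ℕ.* d ℕ.≤ c ℕ.* b → a /ᴺ b ℚ.≤ c /ᴺ d
/ᴺ-mono-≤ a b@(suc _) c d@(suc _) ad≤cb = ℚ.toℚᵘ-cancel-≤ (begin
  ℚ.toℚᵘ (a /ᴺ b)  ≃⟨ toℚᵘ-/ᴺ a b ⟩
  + a ℚᵘ./ b       ≤⟨ ℚᵘ.*≤* (subst₂ ℤ._≤_ (ℤ.pos-* a d) (ℤ.pos-* c b) (ℤ.+≤+ ad≤cb)) ⟩
  + c ℚᵘ./ d       ≃⟨ toℚᵘ-/ᴺ c d ⟨
  ℚ.toℚᵘ (c /ᴺ d)  ∎)
  where open ℚᵘ.≤-Reasoning

/ᴺ-mono-< : ∀ a b c d .{{_ : NonZero b}} .{{_ : NonZero d}} →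
            a ℕ.* d ℕ.< c ℕ.* b → a /ᴺ b ℚ.< c /ᴺ d
/ᴺ-mono-< a b@(suc _) c d@(suc _) ad<cb = ℚ.toℚᵘ-cancel-< (begin-strict
  ℚ.toℚᵘ (a /ᴺ b)  ≃⟨ toℚᵘ-/ᴺ a b ⟩
  + a ℚᵘ./ b       <⟨ ℚᵘ.*<* (subst₂ ℤ._<_ (ℤ.pos-* a d) (ℤ.pos-* c b) (ℤ.+<+ ad<cb)) ⟩
  + c ℚᵘ./ d       ≃⟨ toℚᵘ-/ᴺ c d ⟨
  ℚ.toℚᵘ (c /ᴺ d)  ∎)
  where open ℚᵘ.≤-Reasoning

/ᴺ-+ : ∀ a b c d .{{_ : NonZero b}} .{{_ : NonZero d}} .{{_ : NonZero (b ℕ.* d)}} →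
       a /ᴺ b ℚ.+ c /ᴺ d ≡ (a ℕ.* d ℕ.+ c ℕ.* b) /ᴺ (b ℕ.* d)
/ᴺ-+ a b@(suc _) c d@(suc _) = ℚ.toℚᵘ-injective (begin-equality
  ℚ.toℚᵘ (a /ᴺ b ℚ.+ c /ᴺ d)                  ≃⟨ ℚ.toℚᵘ-homo-+ (a /ᴺ b) (c /ᴺ d) ⟩
  ℚ.toℚᵘ (a /ᴺ b) ℚᵘ.+ ℚ.toℚᵘ (c /ᴺ d)        ≃⟨ ℚᵘ.+-cong (toℚᵘ-/ᴺ a b) (toℚᵘ-/ᴺ c d) ⟩
  (+ a ℚᵘ./ b) ℚᵘ.+ (+ c ℚᵘ./ d)              ≡⟨ cong (ℚᵘ._/ (b ℕ.* d)) numerators ⟩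
  + (a ℕ.* d ℕ.+ c ℕ.* b) ℚᵘ./ (b ℕ.* d)      ≃⟨ toℚᵘ-/ᴺ (a ℕ.* d ℕ.+ c ℕ.* b) (b ℕ.* d) ⟨
  ℚ.toℚᵘ ((a ℕ.* d ℕ.+ c ℕ.* b) /ᴺ (b ℕ.* d)) ∎)
  where
  open ℚᵘ.≤-Reasoning
  numerators : + a ℤ.* + d ℤ.+ + c ℤ.* + b ≡ + (a ℕ.* d ℕ.+ c ℕ.* b)
  numerators = sym (trans (ℤ.pos-+ (a ℕ.* d) (c ℕ.* b)) (cong₂ ℤ._+_ (ℤ.pos-* a d) (ℤ.pos-* c b)))

/ᴺ-suc : ∀ j m → suc j /ᴺ suc m ≡ j /ᴺ suc m ℚ.+ 1 /ᴺ suc m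
/ᴺ-suc j m = trans (ℚ.≤-antisym
  (/ᴺ-mono-≤ (suc j) (suc m) (j ℕ.* suc m ℕ.+ 1 ℕ.* suc m) (suc m ℕ.* suc m)
    (ℕ.≤-reflexive cross))
  (/ᴺ-mono-≤ (j ℕ.* suc m ℕ.+ 1 ℕ.* suc m) (suc m ℕ.* suc m) (suc j) (suc m)
    (ℕ.≤-reflexive (sym cross))))
  (sym (/ᴺ-+ j (suc m) 1 (suc m)))
  where
  open ℕ.+-*-Solver
  cross : suc j ℕ.* (suc m ℕ.* suc m) ≡ (j ℕ.* suc m ℕ.+ 1 ℕ.* suc m) ℕ.* suc m
  cross = solve 2 (λ j m → (con 1 :+ j) :* (m :* m) := (j :* m :+ con 1 :* m) :* m) refl j (suc m)

/ᴺ-nonneg : ∀ a b .{{_ : NonZero b}} → 0ℚ ℚ.≤ a /ᴺ b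
/ᴺ-nonneg a b = /ᴺ-mono-≤ 0 1 a b ℕ.z≤n

-- A positive ε with denominator b is at least 1/b, so k ≥ Db is enough.
/ᴺ-small : ∀ D {ε} → 0ℚ ℚ.< ε → ∃[ N ] (∀ k → N ℕ.≤ k → D /ᴺ suc k ℚ.≤ ε)
/ᴺ-small D {ε@(mkℚ (+ suc a) b-1 _)} _ = D ℕ.* suc b-1 , λ k Db≤k →
  subst (D /ᴺ suc k ℚ.≤_) (ℚ.↥p/↧p≡p ε) (/ᴺ-mono-≤ D (suc k) (suc a) (suc b-1)
    (ℕ.≤-trans Db≤k (ℕ.≤-trans (ℕ.n≤1+n k) (ℕ.m≤m+n (suc k) (a ℕ.* suc k)))))
/ᴺ-small D {mkℚ (+ zero) _ _} (ℚ.*<* (ℤ.+<+ ()))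
/ᴺ-small D {mkℚ (ℤ.-[1+ _ ]) _ _} (ℚ.*<* ())

-- For q = a/b ≥ 0, q ≤ a < (a(m+1) + 1)/(m+1).
/ᴺ-unbounded : ∀ q m → ∃[ K ] (q ℚ.< K /ᴺ suc m)
/ᴺ-unbounded q@(mkℚ (+ a) b-1 _) m = suc (a ℕ.* suc m) ,
  subst (ℚ._< suc (a ℕ.* suc m) /ᴺ suc m) (ℚ.↥p/↧p≡p q)
    (/ᴺ-mono-< a (suc b-1) (suc (a ℕ.* suc m)) (suc m)
      (ℕ.m≤m*n (suc (a ℕ.* suc m)) (suc b-1)))
/ᴺ-unbounded q@(mkℚ (ℤ.-[1+ _ ]) _ _) m = 0 , ℚ.<-≤-trans (ℚ.negative⁻¹ q) (/ᴺ-nonneg 0 (suc m))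

-- Infima

∣p-q∣≤δ : ∀ {p q δ} → p ℚ.≤ q ℚ.+ δ → q ℚ.≤ p ℚ.+ δ → ∣ p ℚ.- q ∣ ℚ.≤ δ
∣p-q∣≤δ {p} {q} {δ} p≤ q≤ with ℚ.∣p∣≡p∨∣p∣≡-p (p ℚ.- q)
... | inj₁ eq = begin
  ∣ p ℚ.- q ∣        ≡⟨ eq ⟩
  p ℚ.- q            ≤⟨ ℚ.+-monoˡ-≤ (ℚ.- q) p≤ ⟩
  (q ℚ.+ δ) ℚ.- q    ≡⟨ solve 2 (λ q δ → (q :+ δ) :- q := δ) refl q δ ⟩
  δ                  ∎
  where
  open ℚ.≤-Reasoning
  open +-*-Solver
... | inj₂ eq = begin
  ∣ p ℚ.- q ∣        ≡⟨ eq ⟩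
  ℚ.- (p ℚ.- q)      ≡⟨ solve 2 (λ p q → :- (p :- q) := q :- p) refl p q ⟩
  q ℚ.- p            ≤⟨ ℚ.+-monoˡ-≤ (ℚ.- p) q≤ ⟩
  (p ℚ.+ δ) ℚ.- p    ≡⟨ solve 2 (λ q δ → (q :+ δ) :- q := δ) refl p δ ⟩
  δ                  ∎
  where
  open ℚ.≤-Reasoning
  open +-*-Solver

LowerBound : Pred ℚ 0ℓ → ℚ → Set
LowerBound S a = ∀ q → S q → a ℚ.≤ q

-- The infimum is the limit of rational lower bounds: the m-th one lies on the grid of multiples of
-- 1/(m+1) and has an element of `S` at most one grid step above it.
module _ (em : ExcludedMiddle 0ℓ) {S : Pred ℚ 0ℓ}
         (0≤S : LowerBound S 0ℚ) (nonempty : ∃[ q ] S q) where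

  private
    Near : ℚ → ℚ → Set
    Near δ a = LowerBound S a × ∃[ q ] (S q × q ℚ.≤ a ℚ.+ δ)

    step : ∀ a → LowerBound S a ⊎ ∃[ q ] (S q × q ℚ.≤ a)
    step a with em {∃[ q ] (S q × q ℚ.≤ a)}
    ... | yes found = inj₂ found
    ... | no ¬found = inj₁ λ q Sq → ℚ.<⇒≤ (ℚ.≰⇒> λ q≤a → ¬found (q , Sq , q≤a))

    -- Climb the grid from 0. At the first point with an element of `S` at or below it, the
    -- preceding point is still a lower bound and that element is within one step of it.
    search : ∀ m K → LowerBound S (K /ᴺ suc m) ⊎ ∃[ a ] Near (1 /ᴺ suc m) a
    search m zero = inj₁ (subst (LowerBound S)
      (ℚ.≤-antisym (/ᴺ-nonneg 0 (suc m)) (/ᴺ-mono-≤ 0 (suc m) 0 1 ℕ.z≤n)) 0≤S)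
    search m (suc K) with search m K
    ... | inj₂ found = inj₂ found
    ... | inj₁ lower with step (suc K /ᴺ suc m)
    ...   | inj₁ lower′         = inj₁ lower′
    ...   | inj₂ (q , Sq , q≤a) = inj₂
      (K /ᴺ suc m , lower , q , Sq , subst (q ℚ.≤_) (/ᴺ-suc K m) q≤a)

    near : ∀ m → ∃[ a ] Near (1 /ᴺ suc m) a
    near m with /ᴺ-unbounded (proj₁ nonempty) m
    ... | K , q<K with search m K
    ...   | inj₂ found = found
    -- The grid point `K` was chosen beyond a known element of `S`, so the climb must have stopped
    -- earlier.
    ...   | inj₁ lower = contradiction
      (ℚ.<-≤-trans q<K (lower (proj₁ nonempty) (proj₂ nonempty))) (ℚ.<-irrefl refl)

    approx : ℕ → ℚ
    approx m = proj₁ (near m)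

    approx-lower : ∀ m → LowerBound S (approx m)
    approx-lower m = proj₁ (proj₂ (near m))

    -- Any lower bound stays below the element of `S` that witnesses closeness at stage `n`. Used in
    -- both orders, this gives the Cauchy property.
    approx-close : ∀ m n → approx m ℚ.≤ approx n ℚ.+ 1 /ᴺ suc n
    approx-close m n with proj₂ (proj₂ (near n))
    ... | q , Sq , q≤ = ℚ.≤-trans (approx-lower m q Sq) q≤

    approx-cauchy : IsCauchy approx
    approx-cauchy ε 0<ε with /ᴺ-small 1 (half-pos 0<ε)
    ... | N , small = N , λ m n N≤m N≤n → ℚ.≤-<-trans
      (∣p-q∣≤δ (within m n N≤n) (within n m N≤m))
      (begin-strict
        ε ℚ.* ½               ≡⟨ ℚ.+-identityʳ (ε ℚ.* ½) ⟨
        ε ℚ.* ½ ℚ.+ 0ℚ        <⟨ ℚ.+-monoʳ-< (ε ℚ.* ½) (half-pos 0<ε) ⟩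
        ε ℚ.* ½ ℚ.+ ε ℚ.* ½   ≡⟨ halves ε ⟩
        ε                     ∎)
      where
      open ℚ.≤-Reasoning
      within : ∀ m n → N ℕ.≤ n → approx m ℚ.≤ approx n ℚ.+ ε ℚ.* ½
      within m n N≤n = ℚ.≤-trans (approx-close m n) (ℚ.+-monoʳ-≤ (approx n) (small n N≤n))

  infimum : ∃[ x ] IsInfimum S x
  infimum = mkℝ approx approx-cauchy , is-lower , greatest
    where
    open ℚ.≤-Reasoning
    open +-*-Solver

    is-lower : ∀ q → S q → mkℝ approx approx-cauchy ≤ᵣ fromℚ q
    is-lower q Sq ε 0<ε = 0 , λ n _ → begin
      approx n    ≤⟨ approx-lower n q Sq ⟩
      q           ≡⟨ ℚ.+-identityʳ q ⟨
      q ℚ.+ 0ℚ    ≤⟨ ℚ.+-monoʳ-≤ q (ℚ.<⇒≤ 0<ε) ⟩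
      q ℚ.+ ε     ∎

    quarters : ∀ a ε → ((a ℚ.+ ε ℚ.* ½ ℚ.* ½) ℚ.+ ε ℚ.* ½ ℚ.* ½) ℚ.+ ε ℚ.* ½ ≡ a ℚ.+ ε
    quarters = solve 2 (λ a ε →
      ((a :+ ε :* con ½ :* con ½) :+ ε :* con ½ :* con ½) :+ ε :* con ½ := a :+ ε) refl

    greatest : ∀ y → (∀ q → S q → y ≤ᵣ fromℚ q) → y ≤ᵣ mkℝ approx approx-cauchy
    -- The budget ε: a quarter for `q` above `approx M`, a quarter for `approx M` above `approx n`,
    -- a half for the slack in the bound of `y` by `q`.
    greatest y y≤S ε 0<ε with /ᴺ-small 1 (half-pos (half-pos 0<ε))
    ... | M , small with proj₂ (proj₂ (near M))
    ... | q , Sq , q≤ with y≤S q Sq (ε ℚ.* ½) (half-pos 0<ε)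
    ... | N , y≤q = M ℕ.⊔ N , λ n M⊔N≤n → begin
      seq y n
        ≤⟨ y≤q n (ℕ.m⊔n≤o⇒n≤o M N M⊔N≤n) ⟩
      q ℚ.+ ε ℚ.* ½
        ≤⟨ ℚ.+-monoˡ-≤ (ε ℚ.* ½) q≤ ⟩
      (approx M ℚ.+ 1 /ᴺ suc M) ℚ.+ ε ℚ.* ½
        ≤⟨ ℚ.+-monoˡ-≤ (ε ℚ.* ½) (ℚ.+-mono-≤ (approx-close M n) (small M ℕ.≤-refl)) ⟩
      ((approx n ℚ.+ 1 /ᴺ suc n) ℚ.+ ε ℚ.* ½ ℚ.* ½) ℚ.+ ε ℚ.* ½
        ≤⟨ ℚ.+-monoˡ-≤ (ε ℚ.* ½) (ℚ.+-monoˡ-≤ (ε ℚ.* ½ ℚ.* ½)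
             (ℚ.+-monoʳ-≤ (approx n) (small n (ℕ.m⊔n≤o⇒m≤o M N M⊔N≤n)))) ⟩
      ((approx n ℚ.+ ε ℚ.* ½ ℚ.* ½) ℚ.+ ε ℚ.* ½ ℚ.* ½) ℚ.+ ε ℚ.* ½
        ≡⟨ quarters (approx n) ε ⟩
      approx n ℚ.+ ε
        ∎

-- This is how the limit in k enters: it replaces one bound on `y` by bounds exceeding `q` by
-- arbitrarily little.
≤ᵣ-approximable : ∀ y q → (∀ ε → 0ℚ ℚ.< ε → ∃[ t ] (y ≤ᵣ fromℚ t × t ℚ.≤ q ℚ.+ ε)) →
                  y ≤ᵣ fromℚ q
≤ᵣ-approximable y q approximable ε 0<ε with approximable (ε ℚ.* ½) (half-pos 0<ε)
... | t , y≤t , t≤ with y≤t (ε ℚ.* ½) (half-pos 0<ε)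
... | N , h = N , λ n N≤n → begin
  seq y n                              ≤⟨ h n N≤n ⟩
  t ℚ.+ ε ℚ.* ½                        ≤⟨ ℚ.+-monoˡ-≤ (ε ℚ.* ½) t≤ ⟩
  (q ℚ.+ ε ℚ.* ½) ℚ.+ ε ℚ.* ½          ≡⟨ ℚ.+-assoc q (ε ℚ.* ½) (ε ℚ.* ½) ⟩
  q ℚ.+ (ε ℚ.* ½ ℚ.+ ε ℚ.* ½)          ≡⟨ cong (q ℚ.+_) (halves ε) ⟩
  q ℚ.+ ε                              ∎
  where open ℚ.≤-Reasoning

-- Since r ≥ 1, kd/(kr+1) ≤ d/r and D/(kr+1) ≤ D/(k+1). After cross-multiplication the right side
-- exceeds the left by the natural number `rest`; writing r as a successor keeps subtraction out of
-- it.
/ᴺ-mediant : ∀ k d D r .{{_ : NonZero r}} →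
             (k ℕ.* d ℕ.+ D) /ᴺ suc (k ℕ.* r) ℚ.≤ d /ᴺ r ℚ.+ D /ᴺ suc k
/ᴺ-mediant k d D r@(suc r-1) = subst ((k ℕ.* d ℕ.+ D) /ᴺ suc (k ℕ.* r) ℚ.≤_)
  (sym (/ᴺ-+ d r D (suc k)))
  (/ᴺ-mono-≤ (k ℕ.* d ℕ.+ D) (suc (k ℕ.* r)) (d ℕ.* suc k ℕ.+ D ℕ.* r) (r ℕ.* suc k) cross)
  where
  open ℕ.+-*-Solver
  lhs rest : ℕ → ℕ → ℕ → ℕ → ℕ
  lhs k d D r-1 = (k ℕ.* d ℕ.+ D) ℕ.* (suc r-1 ℕ.* suc k)
  rest k d D r-1 = d ℕ.* suc k ℕ.+ D ℕ.* suc r-1 ℕ.* (k ℕ.* r-1)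
  excess : ∀ k d D r-1 → (d ℕ.* suc k ℕ.+ D ℕ.* suc r-1) ℕ.* suc (k ℕ.* suc r-1) ≡
                         lhs k d D r-1 ℕ.+ rest k d D r-1
  excess = solve 4 (λ k d D r-1 →
    (d :* (con 1 :+ k) :+ D :* (con 1 :+ r-1)) :* (con 1 :+ k :* (con 1 :+ r-1)) :=
    (k :* d :+ D) :* ((con 1 :+ r-1) :* (con 1 :+ k)) :+
    (d :* (con 1 :+ k) :+ D :* (con 1 :+ r-1) :* (k :* r-1))) refl
  cross : lhs k d D r-1 ℕ.≤ (d ℕ.* suc k ℕ.+ D ℕ.* suc r-1) ℕ.* suc (k ℕ.* suc r-1)
  cross = subst (lhs k d D r-1 ℕ.≤_) (sym (excess k d D r-1)) (ℕ.m≤m+n (lhs k d D r-1) (rest k d D r-1))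

-- The complex numbers

1ℂ : ℂ
1ℂ = fromℚ 1ℚ +i fromℚ 0ℚ

-ℂ_ : ℂ → ℂ
-ℂ z = (-ᵣ re z) +i (-ᵣ im z)

≈-pointwise : ∀ z w → (∀ n → seq (re z) n ≡ seq (re w) n) →
              (∀ n → seq (im z) n ≡ seq (im w) n) → z ≈ w
≈-pointwise z w re≡ im≡ = ≃-pointwise (re z) (re w) re≡ , ≃-pointwise (im z) (im w) im≡

≈-refl : ∀ z → z ≈ z
≈-refl z = ≈-pointwise z z (λ _ → refl) (λ _ → refl)

≈-reflexive : ∀ {z w} → z ≡ w → z ≈ w
≈-reflexive {z} refl = ≈-refl z

≈-sym : ∀ z w → z ≈ w → w ≈ z
≈-sym z w (re≃ , im≃) = ≃-sym (re z) (re w) re≃ , ≃-sym (im z) (im w) im≃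

≈-trans : ∀ x y z → x ≈ y → y ≈ z → x ≈ z
≈-trans x y z (re₁ , im₁) (re₂ , im₂) =
  ≃-trans (re x) (re y) (re z) re₁ re₂ , ≃-trans (im x) (im y) (im z) im₁ im₂

+-cong : ∀ z z′ w w′ → z ≈ z′ → w ≈ w′ → z + w ≈ z′ + w′
+-cong z z′ w w′ (re₁ , im₁) (re₂ , im₂) =
  +ᵣ-cong (re z) (re z′) (re w) (re w′) re₁ re₂ ,
  +ᵣ-cong (im z) (im z′) (im w) (im w′) im₁ im₂

-ℂ-cong : ∀ z w → z ≈ w → -ℂ z ≈ -ℂ w
-ℂ-cong z w (re≃ , im≃) = -ᵣ-cong (re z) (re w) re≃ , -ᵣ-cong (im z) (im w) im≃

conjugate-cong : ∀ z w → z ≈ w → conj z ≈ conj w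
conjugate-cong z w (re≃ , im≃) = re≃ , -ᵣ-cong (im z) (im w) im≃

*-cong : ∀ z z′ w w′ → z ≈ z′ → w ≈ w′ → z * w ≈ z′ * w′
*-cong (a +i b) (a′ +i b′) (c +i d) (c′ +i d′) (a≃ , b≃) (c≃ , d≃) =
  +ᵣ-cong (a *ᵣ c) (a′ *ᵣ c′) (-ᵣ (b *ᵣ d)) (-ᵣ (b′ *ᵣ d′))
    (*ᵣ-cong a a′ c c′ a≃ c≃)
    (-ᵣ-cong (b *ᵣ d) (b′ *ᵣ d′) (*ᵣ-cong b b′ d d′ b≃ d≃)) ,
  +ᵣ-cong (a *ᵣ d) (a′ *ᵣ d′) (b *ᵣ c) (b′ *ᵣ c′)
    (*ᵣ-cong a a′ d d′ a≃ d≃) (*ᵣ-cong b b′ c c′ b≃ c≃)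

+-assoc : ∀ x y z → (x + y) + z ≈ x + (y + z)
+-assoc x y z = ≈-pointwise ((x + y) + z) (x + (y + z))
  (λ n → ℚ.+-assoc (seq (re x) n) (seq (re y) n) (seq (re z) n))
  (λ n → ℚ.+-assoc (seq (im x) n) (seq (im y) n) (seq (im z) n))

+-comm : ∀ x y → x + y ≈ y + x
+-comm x y = ≈-pointwise (x + y) (y + x)
  (λ n → ℚ.+-comm (seq (re x) n) (seq (re y) n))
  (λ n → ℚ.+-comm (seq (im x) n) (seq (im y) n))

+-identityˡ : ∀ x → 0ℂ + x ≈ x
+-identityˡ x = ≈-pointwise (0ℂ + x) x
  (λ n → ℚ.+-identityˡ (seq (re x) n)) (λ n → ℚ.+-identityˡ (seq (im x) n))

+-inverseʳ : ∀ x → x + (-ℂ x) ≈ 0ℂ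
+-inverseʳ x = ≈-pointwise (x + (-ℂ x)) 0ℂ
  (λ n → ℚ.+-inverseʳ (seq (re x) n)) (λ n → ℚ.+-inverseʳ (seq (im x) n))

*-assoc : ∀ x y z → (x * y) * z ≈ x * (y * z)
*-assoc x y z = ≈-pointwise ((x * y) * z) (x * (y * z))
  (λ n → real (seq (re x) n) (seq (im x) n) (seq (re y) n) (seq (im y) n) (seq (re z) n) (seq (im z) n))
  (λ n → imag (seq (re x) n) (seq (im x) n) (seq (re y) n) (seq (im y) n) (seq (re z) n) (seq (im z) n))
  where
  open +-*-Solver
  real = solve 6 (λ a b c d e f →
    (a :* c :+ :- (b :* d)) :* e :+ :- ((a :* d :+ b :* c) :* f) :=
    a :* (c :* e :+ :- (d :* f)) :+ :- (b :* (c :* f :+ d :* e))) refl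
  imag = solve 6 (λ a b c d e f →
    (a :* c :+ :- (b :* d)) :* f :+ (a :* d :+ b :* c) :* e :=
    a :* (c :* f :+ d :* e) :+ b :* (c :* e :+ :- (d :* f))) refl

*-comm : ∀ x y → x * y ≈ y * x
*-comm x y = ≈-pointwise (x * y) (y * x)
  (λ n → real (seq (re x) n) (seq (im x) n) (seq (re y) n) (seq (im y) n))
  (λ n → imag (seq (re x) n) (seq (im x) n) (seq (re y) n) (seq (im y) n))
  where
  open +-*-Solver
  real = solve 4 (λ a b c d → a :* c :+ :- (b :* d) := c :* a :+ :- (d :* b)) refl
  imag = solve 4 (λ a b c d → a :* d :+ b :* c := c :* b :+ d :* a) refl

*-identityˡ : ∀ x → 1ℂ * x ≈ x
*-identityˡ x = ≈-pointwise (1ℂ * x) x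
  (λ n → real (seq (re x) n) (seq (im x) n)) (λ n → imag (seq (re x) n) (seq (im x) n))
  where
  open +-*-Solver
  real = solve 2 (λ a b → con 1ℚ :* a :+ :- (con 0ℚ :* b) := a) refl
  imag = solve 2 (λ a b → con 1ℚ :* b :+ con 0ℚ :* a := b) refl

*-distribʳ-+ : ∀ x y z → (y + z) * x ≈ y * x + z * x
*-distribʳ-+ x y z = ≈-pointwise ((y + z) * x) (y * x + z * x)
  (λ n → real (seq (re x) n) (seq (im x) n) (seq (re y) n) (seq (im y) n) (seq (re z) n) (seq (im z) n))
  (λ n → imag (seq (re x) n) (seq (im x) n) (seq (re y) n) (seq (im y) n) (seq (re z) n) (seq (im z) n))
  where
  open +-*-Solver
  real = solve 6 (λ a b c d e f →
    (c :+ e) :* a :+ :- ((d :+ f) :* b) :=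
    (c :* a :+ :- (d :* b)) :+ (e :* a :+ :- (f :* b))) refl
  imag = solve 6 (λ a b c d e f →
    (c :+ e) :* b :+ (d :+ f) :* a := (c :* b :+ d :* a) :+ (e :* b :+ f :* a)) refl

conjugate-+ : ∀ x y → conj (x + y) ≈ conj x + conj y
conjugate-+ x y = ≈-pointwise (conj (x + y)) (conj x + conj y)
  (λ _ → refl) (λ n → ℚ.neg-distrib-+ (seq (im x) n) (seq (im y) n))

conjugate-* : ∀ x y → conj (x * y) ≈ conj x * conj y
conjugate-* x y = ≈-pointwise (conj (x * y)) (conj x * conj y)
  (λ n → real (seq (re x) n) (seq (im x) n) (seq (re y) n) (seq (im y) n))
  (λ n → imag (seq (re x) n) (seq (im x) n) (seq (re y) n) (seq (im y) n))
  where
  open +-*-Solver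
  real = solve 4 (λ a b c d → a :* c :+ :- (b :* d) := a :* c :+ :- (:- b :* :- d)) refl
  imag = solve 4 (λ a b c d → :- (a :* d :+ b :* c) := a :* :- d :+ :- b :* c) refl

conjugate-involutive : ∀ x → conj (conj x) ≈ x
conjugate-involutive x = ≈-pointwise (conj (conj x)) x
  (λ _ → refl) (λ n → neg-involutive (seq (im x) n))
  where
  open +-*-Solver
  neg-involutive = solve 1 (λ a → :- (:- a) := a) refl

null⇒≃0 : ∀ x → IsNull (seq x) → x ≃ fromℚ 0ℚ
null⇒≃0 x = null-cong λ n → sym (ℚ.+-identityʳ (seq x n))

≃0⇒null : ∀ x → x ≃ fromℚ 0ℚ → IsNull (seq x)
≃0⇒null x = null-cong λ n → ℚ.+-identityʳ (seq x n)

∣_∣² : ℂ → ℝ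
∣ z ∣² = re z *ᵣ re z +ᵣ im z *ᵣ im z

∣∣²-nonneg : ∀ z n → 0ℚ ℚ.≤ seq ∣ z ∣² n
∣∣²-nonneg z n = +-nonneg (square-nonneg (seq (re z) n)) (square-nonneg (seq (im z) n))

∣∣²-definite : ∀ z → IsNull (seq ∣ z ∣²) → z ≈ 0ℂ
∣∣²-definite z zz→0 =
  null⇒≃0 (re z) (null-square (null-+-nonnegˡ re² im² zz→0)) ,
  null⇒≃0 (im z) (null-square (null-+-nonnegʳ re² im² zz→0))
  where
  re² : ∀ n → 0ℚ ℚ.≤ seq (re z) n ℚ.* seq (re z) n
  re² n = square-nonneg (seq (re z) n)
  im² : ∀ n → 0ℚ ℚ.≤ seq (im z) n ℚ.* seq (im z) n
  im² n = square-nonneg (seq (im z) n)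

∣∣²≡conj : ∀ z n → seq ∣ z ∣² n ≡ seq (re (conj z * z)) n
∣∣²≡conj z n = solve 2 (λ a b → a :* a :+ b :* b := a :* a :+ :- (:- b :* b)) refl
  (seq (re z) n) (seq (im z) n)
  where open +-*-Solver

⟨⟩-nonneg : ∀ {d} (v : ℂ^ d) n → 0ℚ ℚ.≤ seq (re ⟨ v , v ⟩) n
⟨⟩-nonneg {zero}  v n = ℚ.≤-refl
⟨⟩-nonneg {suc d} v n = +-nonneg
  (subst (0ℚ ℚ.≤_) (∣∣²≡conj (v zero) n) (∣∣²-nonneg (v zero) n)) (⟨⟩-nonneg (v ∘ suc) n)

-- The rational terms that represent each squared modulus are nonnegative, so each summand is
-- dominated termwise by the whole sum and is null with it.
⟨⟩-null : ∀ {d} (v : ℂ^ d) → IsNull (seq (re ⟨ v , v ⟩)) → ∀ i → v i ≈ 0ℂ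
⟨⟩-null {suc d} v vv→0 zero = ∣∣²-definite (v zero)
  (null-cong (λ n → sym (∣∣²≡conj (v zero) n))
    (null-+-nonnegˡ (λ n → subst (0ℚ ℚ.≤_) (∣∣²≡conj (v zero) n) (∣∣²-nonneg (v zero) n))
                    (⟨⟩-nonneg (v ∘ suc)) vv→0))
⟨⟩-null {suc d} v vv→0 (suc i) = ⟨⟩-null (v ∘ suc)
  (null-+-nonnegʳ (λ n → subst (0ℚ ℚ.≤_) (∣∣²≡conj (v zero) n) (∣∣²-nonneg (v zero) n))
                  (⟨⟩-nonneg (v ∘ suc)) vv→0) i

1≄0 : ¬ fromℚ 1ℚ ≃ fromℚ 0ℚ
1≄0 1≃0 with 1≃0 1ℚ (ℚ.positive⁻¹ 1ℚ)
... | N , h = ℚ.<-irrefl refl (h N ℕ.≤-refl)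

reciprocal : ExcludedMiddle 0ℓ → ∀ z → ¬ z ≈ 0ℂ → ∃[ w ] z * w ≈ 1ℂ
reciprocal em z z≉0 = w , real≃1 , imag≃0
  where
  inverse : ∃[ y ] (∣ z ∣² *ᵣ y ≃ fromℚ 1ℚ)
  inverse = inverseᵣ em ∣ z ∣² (λ zz→0 → z≉0 (∣∣²-definite z zz→0))
  y : ℝ
  y = proj₁ inverse
  -- The conjugate of `z` divided by its squared modulus.
  w : ℂ
  w = (re z *ᵣ y) +i ((-ᵣ im z) *ᵣ y)
  open +-*-Solver
  real : ∀ a b y → a ℚ.* (a ℚ.* y) ℚ.+ ℚ.- (b ℚ.* (ℚ.- b ℚ.* y)) ≡ (a ℚ.* a ℚ.+ b ℚ.* b) ℚ.* y
  real = solve 3 (λ a b y → a :* (a :* y) :+ :- (b :* (:- b :* y)) := (a :* a :+ b :* b) :* y) refl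
  imag : ∀ a b y → a ℚ.* (ℚ.- b ℚ.* y) ℚ.+ b ℚ.* (a ℚ.* y) ≡ 0ℚ
  imag = solve 3 (λ a b y → a :* (:- b :* y) :+ b :* (a :* y) := con 0ℚ) refl
  real≃1 : re (z * w) ≃ fromℚ 1ℚ
  real≃1 = ≃-trans (re (z * w)) (∣ z ∣² *ᵣ y) (fromℚ 1ℚ)
    (≃-pointwise (re (z * w)) (∣ z ∣² *ᵣ y)
      (λ n → real (seq (re z) n) (seq (im z) n) (seq y n)))
    (proj₂ inverse)
  imag≃0 : im (z * w) ≃ fromℚ 0ℚ
  imag≃0 = ≃-pointwise (im (z * w)) (fromℚ 0ℚ)
    (λ n → imag (seq (re z) n) (seq (im z) n) (seq y n))

ℂ-commutativeRing : CommutativeRing 0ℓ 0ℓ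
ℂ-commutativeRing = record
  { Carrier = ℂ
  ; _≈_ = _≈_
  ; _+_ = _+_
  ; _*_ = _*_
  ; -_ = -ℂ_
  ; 0# = 0ℂ
  ; 1# = 1ℂ
  ; isCommutativeRing = record
    { isRing = record
      { +-isAbelianGroup = record
        { isGroup = record
          { isMonoid = record
            { isSemigroup = record
              { isMagma = record
                { isEquivalence = record
                  { refl  = λ {x} → ≈-refl x
                  ; sym   = λ {x y} → ≈-sym x y
                  ; trans = λ {x y z} → ≈-trans x y z
                  }
                ; ∙-cong = λ {x y u v} → +-cong x y u v
                }
              ; assoc = +-assoc
              }
            ; identity = +-identityˡ , λ x → ≈-trans (x + 0ℂ) (0ℂ + x) x (+-comm x 0ℂ) (+-identityˡ x)
            }
          ; inverse =
              (λ x → ≈-trans ((-ℂ x) + x) (x + (-ℂ x)) 0ℂ (+-comm (-ℂ x) x) (+-inverseʳ x)) ,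
              +-inverseʳ
          ; ⁻¹-cong = λ {x y} → -ℂ-cong x y
          }
        ; comm = +-comm
        }
      ; *-cong = λ {x y u v} → *-cong x y u v
      ; *-assoc = *-assoc
      ; *-identity = *-identityˡ , λ x → ≈-trans (x * 1ℂ) (1ℂ * x) x (*-comm x 1ℂ) (*-identityˡ x)
      ; distrib = (λ x y z → ≈-trans (x * (y + z)) ((y + z) * x) (x * y + x * z) (*-comm x (y + z))
                     (≈-trans ((y + z) * x) (y * x + z * x) (x * y + x * z) (*-distribʳ-+ x y z)
                       (+-cong (y * x) (x * y) (z * x) (x * z) (*-comm y x) (*-comm z x))))
                , *-distribʳ-+
      }
    ; *-comm = *-comm
    }
  }

ℂ-involutiveField : ExcludedMiddle 0ℓ → InvolutiveField 0ℓ 0ℓ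
ℂ-involutiveField em = record
  { commutativeRing = ℂ-commutativeRing
  ; conj            = conj
  ; conj-cong       = λ {x y} → conjugate-cong x y
  ; conj-+          = conjugate-+
  ; conj-*          = conjugate-*
  ; conj-involutive = conjugate-involutive
  ; zero?           = λ x → em
  ; 1≉0             = λ 1≈0 → 1≄0 (proj₁ 1≈0)
  ; inverse         = reciprocal em
  ; definite        = λ v vv≈0 → ⟨⟩-null v (≃0⇒null (re ⟨ v , v ⟩) (proj₁ vv≈0))
  }

-- Subspaces of ℂ^d, and least natural numbers

∋-linComb : ∀ {r d} (S : Subspace d) (c : Fin r → ℂ) (b : Fin r → ℂ^ d) →
            (∀ k → S ∋ b k) → S ∋ linComb c b
∋-linComb {zero}  S c b b∈S = Subspace.0-closed S
∋-linComb {suc r} S c b b∈S = Subspace.+-closed S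
  (Subspace.*-closed S (c zero) (b∈S zero)) (∋-linComb S (c ∘ suc) (b ∘ suc) (b∈S ∘ suc))

infixr 6 _⊕_

_⊕_ : ∀ {d d′} → Subspace d → Subspace d′ → Subspace (d ℕ.+ d′)
_⊕_ {d} {d′} S T = record
  { _∋_      = λ x → S ∋ (λ i → x (i ↑ˡ d′)) × T ∋ (λ i → x (d ↑ʳ i))
  ; resp     = λ x≈y (x∈S , x∈T) →
      Subspace.resp S (λ i → x≈y (i ↑ˡ d′)) x∈S , Subspace.resp T (λ i → x≈y (d ↑ʳ i)) x∈T
  ; 0-closed = Subspace.0-closed S , Subspace.0-closed T
  ; +-closed = λ (x∈S , x∈T) (y∈S , y∈T) →
      Subspace.+-closed S x∈S y∈S , Subspace.+-closed T x∈T y∈T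
  ; *-closed = λ c (x∈S , x∈T) → Subspace.*-closed S c x∈S , Subspace.*-closed T c x∈T
  }

-- Test the candidates upwards; the search ends at the known witness. The level is arbitrary because
-- the predicate will be existence of a faithful representation, a type in `Set₁`.
least : ∀ {ℓ} → ExcludedMiddle ℓ → (P : ℕ → Set ℓ) → ∃[ n ] P n →
        ∃[ m ] (P m × (∀ n → P n → m ℕ.≤ n))
least em P (n , Pn) with below (suc n)
  where
  below : ∀ N → (∀ k → P k → N ℕ.≤ k) ⊎ ∃[ m ] (P m × (∀ k → P k → m ℕ.≤ k))
  below zero = inj₁ λ _ _ → ℕ.z≤n
  below (suc N) with below N
  ... | inj₂ found = inj₂ found
  ... | inj₁ N≤P with em {P N}
  ...   | yes PN = inj₂ (N , PN , N≤P)
  ...   | no ¬PN = inj₁ λ k Pk → ℕ.≤∧≢⇒< (N≤P k Pk) λ { refl → ¬PN Pk }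
... | inj₂ found = found
... | inj₁ n<P   = contradiction (n<P n Pn) (ℕ.<-irrefl refl)

module _ (em : ExcludedMiddle 0ℓ) where

  open LinearAlgebra (ℂ-involutiveField em) using
    ( Span; span-resp; span-0; span-+; span-*; column; image⇒span; span⇒image; images-orthogonal
    ; Projection; projection; projections-orthogonal; independent⇒≤
    ; _⊞_; ⊞-independent; ⊞-span; ⊞-member; ⟨0++,⟩; sum-↑
    ; span∋single; single-independent; indicator; indicator-true; indicators-overlap; indicators-disjoint )

  span : ∀ {r d} → (Fin r → ℂ^ d) → Subspace d
  span b = record
    { _∋_      = Span b
    ; resp     = λ {x y} → span-resp b {x} {y}
    ; 0-closed = span-0 b
    ; +-closed = λ {x y} → span-+ b {x} {y}
    ; *-closed = λ c {x} → span-* b c {x}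
    }

  -- From faithful representations of G to projections

  projectiveRepresentation : ∀ {n d r} (G : Graph n) → NonZero n →
    FaithfulOrthogonalSubspaceRepresentation G d r → ProjectiveRepresentation (complement G) d r
  projectiveRepresentation {suc n} {d} {r} G _ F = record
    -- Here a vertex must exist. Without vertices, d = 0 would be faithful for every r, whereas r ≤
    -- d keeps every projective ratio at least 1.
    { r≤d        = independent⇒≤ (b zero) (b-independent zero)
    ; P          = λ u → P.P u
    ; rank       = λ u → b u , P.image∋b u , b-independent u , P.image⊆span u
    ; hermitian  = λ u → P.hermitian u
    ; idempotent = λ u → P.idempotent u
    ; orthogonal = λ u v (u≢v , ¬uv) → projections-orthogonal (projection (b u)) (projection (b v))
        λ x y x∈u y∈v →
          Equivalence.from (F.faithful u v u≢v) ¬uv x y (span⊆S u x x∈u) (span⊆S v y y∈v)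
    }
    where
    module F = FaithfulOrthogonalSubspaceRepresentation F
    b : ∀ u → Fin r → ℂ^ d
    b u = proj₁ (F.dimension u)
    b-independent : ∀ u → LinearlyIndependent (b u)
    b-independent u = proj₁ (proj₂ (proj₂ (F.dimension u)))
    module P u = Projection (projection (b u))
    span⊆S : ∀ u x → Span (b u) x → F.S u ∋ x
    span⊆S u x (c , x≈) = Subspace.resp (F.S u) (λ i → ≈-sym (x i) (linComb c (b u) i) (x≈ i))
      (∋-linComb (F.S u) c (b u) (proj₁ (proj₂ (F.dimension u))))

  -- Direct sums of representations

  dimension-⊕ : ∀ {d d′ r r′} (S : Subspace d) (T : Subspace d′) →
    HasDimension (S ∋_) r → HasDimension (T ∋_) r′ → HasDimension ((S ⊕ T) ∋_) (r ℕ.+ r′)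
  dimension-⊕ S T (b , b∈S , b-independent , S⊆b) (b′ , b′∈T , b′-independent , T⊆b′) =
    b ⊞ b′ ,
    ⊞-member b b′ {S = S ∋_} {T = T ∋_} (Subspace.resp S) (Subspace.resp T)
      (Subspace.0-closed S) (Subspace.0-closed T) b∈S b′∈T ,
    ⊞-independent b b′ b-independent b′-independent ,
    λ x (x∈S , x∈T) → ⊞-span b b′ x (S⊆b _ x∈S) (T⊆b′ _ x∈T)

  ⊥-⊕ : ∀ {d d′} (S S′ : Subspace d) (T T′ : Subspace d′) →
        S ⊥ˢ S′ → T ⊥ˢ T′ → (S ⊕ T) ⊥ˢ (S′ ⊕ T′)
  ⊥-⊕ {d} {d′} S S′ T T′ S⊥S′ T⊥T′ x y (x∈S , x∈T) (y∈S′ , y∈T′) =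
    ≈-trans ⟨ x , y ⟩ (⟨ xˡ , yˡ ⟩ + ⟨ xʳ , yʳ ⟩) 0ℂ
      (sum-↑ d (λ i → conj (x i) * y i))
      (≈-trans (⟨ xˡ , yˡ ⟩ + ⟨ xʳ , yʳ ⟩) (0ℂ + 0ℂ) 0ℂ
        (+-cong ⟨ xˡ , yˡ ⟩ 0ℂ ⟨ xʳ , yʳ ⟩ 0ℂ (S⊥S′ xˡ yˡ x∈S y∈S′) (T⊥T′ xʳ yʳ x∈T y∈T′))
        (+-identityˡ 0ℂ))
    where
    xˡ yˡ : ℂ^ d
    xˡ i = x (i ↑ˡ d′)
    yˡ i = y (i ↑ˡ d′)
    xʳ yʳ : ℂ^ d′
    xʳ i = x (d ↑ʳ i)
    yʳ i = y (d ↑ʳ i)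

  -- Test on vectors padded with zeros: they lie in the direct sums and have unchanged inner
  -- products.
  ⊕-⊥ : ∀ {d d′} (S S′ : Subspace d) (T T′ : Subspace d′) → (S ⊕ T) ⊥ˢ (S′ ⊕ T′) → T ⊥ˢ T′
  ⊕-⊥ {d} {d′} S S′ T T′ ⊥ x y x∈T y∈T′ =
    ≈-trans ⟨ x , y ⟩ ⟨ 0ᵛ {d} ++ x , 0ᵛ {d} ++ y ⟩ 0ℂ
      (≈-sym ⟨ 0ᵛ {d} ++ x , 0ᵛ {d} ++ y ⟩ ⟨ x , y ⟩ (⟨0++,⟩ {d} x y))
      (⊥ (0ᵛ {d} ++ x) (0ᵛ {d} ++ y) (0++∈ S T x x∈T) (0++∈ S′ T′ y y∈T′))
    where
    0++∈ : (S : Subspace d) (T : Subspace d′) → ∀ x → T ∋ x → (S ⊕ T) ∋ (0ᵛ {d} ++ x)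
    0++∈ S T x x∈T =
      Subspace.resp S (λ i → ≈-reflexive (sym (lookup-++ˡ (0ᵛ {d}) x i))) (Subspace.0-closed S) ,
      Subspace.resp T (λ i → ≈-reflexive (sym (lookup-++ʳ (0ᵛ {d}) x i))) x∈T

  -- Faithfulness weakened to one implication, which is all that projections representing the
  -- complement guarantee for their images.
  record OrthogonalSubspaceRepresentation {n} (G : Graph n) (d r : ℕ) : Set₁ where
    field
      S          : Fin n → Subspace d
      dimension  : ∀ u → HasDimension (S u ∋_) r
      orthogonal : ∀ u v → u ≢ v → ¬ Adj G u v → S u ⊥ˢ S v

  module _ {n} {G : Graph n} where

    forget-faithful : ∀ {d r} → FaithfulOrthogonalSubspaceRepresentation G d r →
                      OrthogonalSubspaceRepresentation G d r
    forget-faithful F = record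
      { S = S ; dimension = dimension
      ; orthogonal = λ u v u≢v → Equivalence.from (faithful u v u≢v) }
      where open FaithfulOrthogonalSubspaceRepresentation F

    images : ∀ {d r} → ProjectiveRepresentation (complement G) d r →
             OrthogonalSubspaceRepresentation G d r
    images R = record
      { S          = λ u → span (column (P u))
      ; dimension  = λ u → let (b , b∈P , b-independent , P⊆b) = rank u in
          b , (λ k → image⇒span (P u) (b k) (b∈P k)) , b-independent ,
          λ x x∈P → P⊆b x (span⇒image (P u) x x∈P)
      ; orthogonal = λ u v u≢v ¬uv → images-orthogonal (P u) (P v) (hermitian u)
          (orthogonal u v (u≢v , ¬uv))
      }
      where open ProjectiveRepresentation R

    -- Orthogonality at non-adjacent pairs holds in both blocks; non-orthogonality at edges is
    -- inherited from the faithful block.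
    _⊕ᴿ_ : ∀ {d d′ r r′} → OrthogonalSubspaceRepresentation G d r →
           FaithfulOrthogonalSubspaceRepresentation G d′ r′ →
           FaithfulOrthogonalSubspaceRepresentation G (d ℕ.+ d′) (r ℕ.+ r′)
    O ⊕ᴿ F = record
      { S         = λ u → O.S u ⊕ F.S u
      ; dimension = λ u → dimension-⊕ (O.S u) (F.S u) (O.dimension u) (F.dimension u)
      ; faithful  = λ u v u≢v → mk⇔
          (λ ⊥ → Equivalence.to (F.faithful u v u≢v) (⊕-⊥ (O.S u) (O.S v) (F.S u) (F.S v) ⊥))
          (λ ¬uv → ⊥-⊕ (O.S u) (O.S v) (F.S u) (F.S v)
            (O.orthogonal u v u≢v ¬uv) (Equivalence.from (F.faithful u v u≢v) ¬uv))
      }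
      where
      module O = OrthogonalSubspaceRepresentation O
      module F = FaithfulOrthogonalSubspaceRepresentation F

    copies : ∀ {d d′ r r′} k → OrthogonalSubspaceRepresentation G d r →
             FaithfulOrthogonalSubspaceRepresentation G d′ r′ →
             FaithfulOrthogonalSubspaceRepresentation G (k ℕ.* d ℕ.+ d′) (k ℕ.* r ℕ.+ r′)
    copies zero O F = F
    copies {d} {d′} {r} {r′} (suc k) O F =
      subst₂ (FaithfulOrthogonalSubspaceRepresentation G)
        (sym (ℕ.+-assoc d (k ℕ.* d) d′)) (sym (ℕ.+-assoc r (k ℕ.* r) r′)) (O ⊕ᴿ copies k O F)

  -- A faithful representation by lines

  module _ {n} (G : Graph n) where

    private
      -- Coordinates are indexed by pairs (i , j) of vertices; those with i = j
      -- keep the vector of an isolated vertex nonzero.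
      Incident : Fin n → Fin n × Fin n → Set
      Incident u (i , j) = (u ≡ i ⊎ u ≡ j) × (i ≡ j ⊎ Adj G i j)

      -- Distinct vertices incident to the same pair are its two ends, so the pair is not diagonal
      -- and must be an edge.
      incident⇒adjacent : ∀ {u v} p → u ≢ v → Incident u p → Incident v p → Adj G u v
      incident⇒adjacent _ u≢v (inj₁ refl , _)         (inj₁ refl , _) = contradiction refl u≢v
      incident⇒adjacent _ u≢v (inj₂ refl , _)         (inj₂ refl , _) = contradiction refl u≢v
      incident⇒adjacent _ u≢v (inj₁ refl , inj₁ refl) (inj₂ refl , _) = contradiction refl u≢v
      incident⇒adjacent _ u≢v (inj₂ refl , inj₁ refl) (inj₁ refl , _) = contradiction refl u≢v
      incident⇒adjacent _ u≢v (inj₁ refl , inj₂ uv)   (inj₂ refl , _) = uv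
      incident⇒adjacent _ u≢v (inj₂ refl , inj₂ vu)   (inj₁ refl , _) = Graph.symmetric G vu

      I : Fin n → Fin (n ℕ.* n) → Set
      I u e = Incident u (remQuot n e)

      I? : ∀ u e → Dec (I u e)
      I? u e = em

      I-combine : ∀ u i j → Incident u (i , j) → I u (combine i j)
      I-combine u i j = subst (Incident u) (sym (Fin.remQuot-combine i j))

      χ : Fin n → ℂ^ (n ℕ.* n)
      χ u e = indicator (I? u e)

    -- The vectors `χ u` are rows of an incidence matrix. Their entries are 0 and 1, so inner
    -- products cannot cancel, and the supports of two distinct vertices meet exactly when these are
    -- adjacent.
    lines : FaithfulOrthogonalSubspaceRepresentation G (n ℕ.* n) 1
    lines = record
      { S         = λ u → span (λ (_ : Fin 1) → χ u)
      ; dimension = λ u → (λ _ → χ u) , (λ _ → span∋single (χ u)) ,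
          single-independent (χ u) (combine u u)
            (indicator-true (I? u (combine u u)) (I-combine u u u (inj₁ refl , inj₁ refl))) ,
          λ x x∈u → x∈u
      ; faithful  = λ u v u≢v → mk⇔
          (λ ⊥ uv → indicators-overlap (I? u) (I? v) (combine u v)
            (I-combine u u v (inj₁ refl , inj₂ uv)) (I-combine v u v (inj₂ refl , inj₂ uv))
            (⊥ (χ u) (χ v) (span∋single (χ u)) (span∋single (χ v))))
          (λ ¬uv → indicators-disjoint (I? u) (I? v)
            (λ e ue ve → ¬uv (incident⇒adjacent (remQuot n e) u≢v ue ve)))
      }

  faithful-multiple : ∀ {n} (G : Graph n) {d r} → OrthogonalSubspaceRepresentation G d r →
    ∀ k → FaithfulOrthogonalSubspaceRepresentation G (k ℕ.* d ℕ.+ n ℕ.* n) (suc (k ℕ.* r))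
  faithful-multiple {n} G {d} {r} O k =
    subst (FaithfulOrthogonalSubspaceRepresentation G (k ℕ.* d ℕ.+ n ℕ.* n))
      (ℕ.+-comm (k ℕ.* r) 1) (copies k O (lines G))

  -- k+1 copies of the representation by lines; this makes every minimum over ambient dimensions one
  -- over a nonempty set.
  faithful-exists : ∀ {n} (G : Graph n) k →
    ∃[ d ] FaithfulOrthogonalSubspaceRepresentation G d (suc k)
  faithful-exists {n} G k = k ℕ.* (n ℕ.* n) ℕ.+ n ℕ.* n ,
    subst (λ r → FaithfulOrthogonalSubspaceRepresentation G (k ℕ.* (n ℕ.* n) ℕ.+ n ℕ.* n) (suc r))
      (ℕ.*-identityʳ k) (faithful-multiple G (forget-faithful (lines G)) k)

-- One real number as the infimum of both sets of ratios

mainTheorem1 : ExcludedMiddle (lsuc 0ℓ) → ∀ (n : ℕ) → NonZero n → (G : Graph n) → ∃[ x ] (IsProjectiveRank (complement G) x × IsFractionalMinPSDRank G x)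
mainTheorem1 em n n≢0 G = x , x-inf , mr , mr-min , is-lower , greatest
  where
  -- Only the minimal ambient dimension asks for excluded middle on types in `Set₁`; everything else
  -- uses this lowered form.
  em₀ : ExcludedMiddle 0ℓ
  em₀ = map′ lower lift em

  nonneg : LowerBound (ProjectiveRatio (complement G)) 0ℚ
  nonneg q (d , r , r≢0 , _ , refl) = /ᴺ-nonneg d r {{r≢0}}

  nonempty : ∃[ q ] ProjectiveRatio (complement G) q
  nonempty = (n ℕ.* n) /ᴺ 1 , n ℕ.* n , 1 , _ ,
    projectiveRepresentation em₀ G n≢0 (lines em₀ G) , refl

  inf : ∃[ x ] IsProjectiveRank (complement G) x
  inf = infimum em₀ nonneg nonempty
  x = proj₁ inf
  x-inf = proj₂ inf

  Rep : ℕ → ℕ → Set₁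
  Rep r d = FaithfulOrthogonalSubspaceRepresentation G d r

  minimum : ∀ k → ∃[ d ] IsMinPSDRank G (suc k) d
  minimum k = least em (Rep (suc k)) (faithful-exists em₀ G k)

  mr : ℕ → ℕ
  mr zero    = 0
  mr (suc k) = proj₁ (minimum k)

  mr-min : ∀ r → NonZero r → IsMinPSDRank G r (mr r)
  mr-min (suc k) _ = proj₂ (minimum k)

  Ratio : Pred ℚ 0ℓ
  Ratio q = ∃[ r ] Σ[ r≢0 ∈ NonZero r ] q ≡ (mr r /ᴺ r) {{r≢0}}

  -- A minimal faithful representation gives projections with the same d and r, so each ratio on
  -- this side is itself a projective ratio.
  is-lower : ∀ q → Ratio q → x ≤ᵣ fromℚ q
  is-lower q (r , r≢0 , q≡) = proj₁ x-inf q
    (mr r , r , r≢0 , projectiveRepresentation em₀ G n≢0 (proj₁ (mr-min r r≢0)) , q≡)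

  greatest : ∀ y → (∀ q → Ratio q → y ≤ᵣ fromℚ q) → y ≤ᵣ x
  greatest y y≤ = proj₂ x-inf y λ { q (d , r , r≢0 , R , refl) →
    ≤ᵣ-approximable y q λ ε 0<ε →
      let instance _ = r≢0
          -- `k` makes the overhead n²/(k+1) at most ε. The rank kr + 1 then has a faithful
          -- representation in dimension kd + n², which bounds `mr m` from above.
          k , small = /ᴺ-small (n ℕ.* n) 0<ε
          m = suc (k ℕ.* r)
          F = faithful-multiple em₀ G (images em₀ R) k
      in mr m /ᴺ m , y≤ _ (m , _ , refl) , (begin
        mr m /ᴺ m
          ≤⟨ /ᴺ-mono-≤ (mr m) m (k ℕ.* d ℕ.+ n ℕ.* n) m
               (ℕ.*-monoˡ-≤ m (proj₂ (mr-min m _) (k ℕ.* d ℕ.+ n ℕ.* n) F)) ⟩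
        (k ℕ.* d ℕ.+ n ℕ.* n) /ᴺ m
          ≤⟨ /ᴺ-mediant k d (n ℕ.* n) r ⟩
        d /ᴺ r ℚ.+ (n ℕ.* n) /ᴺ suc k
          ≤⟨ ℚ.+-monoʳ-≤ (d /ᴺ r) (small k ℕ.≤-refl) ⟩
        d /ᴺ r ℚ.+ ε
          ∎) }
    where open ℚ.≤-Reasoning
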